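{- For every positive integer $k$ there exists a positive integer $f(k)$ such that every strongly $4k$-connected tournament $T$ with minimum out-degree $\delta^+(T) \ge f(k)$ is $k$-linked.
   Context: A tournament is a (finite) directed graph in which, for every pair of distinct vertices $x,y$, exactly one of the directed edges $xy$, $yx$ is present. A directed graph is strongly connected if for any pair of distinct vertices $x$ and $y$ there is a directed path from $x$ to $y$; it is strongly $m$-connected if it remains strongly connected upon removal of any set of at most $m-1$ vertices. A directed graph $D$ is $k$-linked if for any two disjoint sets of vertices $\{x_1,\ldots,x_k\}$ and $\{y_1,\ldots,y_k\}$ (each consisting of $k$ distinct vertices) there are pairwise vertex disjoint directed paths $P_1,\ldots,P_k$ such that $P_i$ has initial vertex $x_i$ and terminal vertex $y_i$ for every $i\in\{1,\ldots,k\}$. $\delta^+(T)$ denotes the minimum out-degree of $T$. -}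

module Defs where

open import Level using (0ℓ)
open import Data.Nat.Base using (ℕ; suc; _<_; _⊓_)
open import Data.Fin.Base using (Fin)
open import Data.Fin.Subset using (Subset; _∈_; _∉_; ∁; ∣_∣)
open import Data.List.Base using (List; []; _∷_)
open import Data.List.Relation.Unary.Unique.Propositional using (Unique)
open import Data.List.Relation.Binary.Disjoint.Propositional using (Disjoint)
open import Data.Product.Base using (Σ-syntax; ∃; _×_; proj₁)
open import Data.Sum.Base using (_⊎_)
open import Data.Vec.Base using (foldr₁; tabulate)
open import Function.Base using (_on_)
open import Function.Definitions using (Injective)
open import Relation.Binary.Core using (Rel)
open import Relation.Binary.Construct.Closure.ReflexiveTransitive using (Star; ε; _◅_)
open import Relation.Binary.PropositionalEquality.Core using (_≡_; _≢_)
open import Relation.Nullary.Negation.Core using (¬_)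

-- Paths, strong connectivity and linkedness are defined for the edge relation
-- of a directed graph on an arbitrary vertex type, so that they also apply to
-- the graph left after deleting vertices.

module _ {V : Set} (_⟶_ : Rel V 0ℓ) where

  vertices : ∀ {x y} → Star _⟶_ x y → List V
  vertices {x} ε       = x ∷ []
  vertices {x} (_ ◅ w) = x ∷ vertices w

  record Path (x y : V) : Set where
    field
      walk   : Star _⟶_ x y
      simple : Unique (vertices walk)

  VertexDisjoint : ∀ {x y x′ y′} → Path x y → Path x′ y′ → Set
  VertexDisjoint P Q = Disjoint (vertices (Path.walk P)) (vertices (Path.walk Q))

  StronglyConnected : Set
  StronglyConnected = ∀ x y → x ≢ y → Path x y

  IsLinked : ℕ → Set
  IsLinked k =
    (x y : Fin k → V) →
    Injective _≡_ _≡_ x → Injective _≡_ _≡_ y → (∀ i j → x i ≢ y j) →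
    Σ[ P ∈ (∀ i → Path (x i) (y i)) ] (∀ i j → i ≢ j → VertexDisjoint (P i) (P j))

record Digraph (n : ℕ) : Set where
  field
    N⁺       : Fin n → Subset n
    loopless : ∀ x → x ∉ N⁺ x

  infix 4 _⟶_
  _⟶_ : Rel (Fin n) 0ℓ
  x ⟶ y = y ∈ N⁺ x

  outdegree : Fin n → ℕ
  outdegree x = ∣ N⁺ x ∣

-- The minimum is only meaningful when there is at least one vertex.
δ⁺ : ∀ {n} → Digraph (suc n) → ℕ
δ⁺ D = foldr₁ _⊓_ (tabulate (Digraph.outdegree D))

module _ {n : ℕ} (D : Digraph n) where
  open Digraph D

  IsTournament : Set
  IsTournament = ∀ x y → x ≢ y → (x ⟶ y × ¬ y ⟶ x) ⊎ (¬ x ⟶ y × y ⟶ x)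

  -- Edge relation of the subgraph induced on the complement of S.  Membership
  -- in ∁ S is proof-irrelevant, so the vertices are exactly those outside S.
  Delete : (S : Subset n) → Rel (∃ λ x → x ∈ ∁ S) 0ℓ
  Delete S = _⟶_ on proj₁

  StronglyMConnected : ℕ → Set
  StronglyMConnected m = (S : Subset n) → ∣ S ∣ < m → StronglyConnected (Delete S)

{-# OPTIONS --safe #-}
-- Let B consist of the vertices of largest in-degree.  From every vertex of large out-degree
-- one reaches every b in B by a path of length at most 3 whose interior avoids any prescribed
-- bounded set: otherwise some vertex outside B would have larger in-degree than b.  It thus
-- suffices to join the xᵢ to the starts of disjoint walks from B to the yᵢ by such short
-- paths, which must avoid these possibly very long walks.
--
-- If the walks have minimum total length, a vertex reachable from B in at most three steps
-- off the walks can lie on a walk only among its first four vertices, and these are few.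
-- So short paths issuing from B, or from out-neighbours of vertices of B, can be kept off
-- the walks.  To leave xᵢ, either many out-neighbours u of xᵢ are dominated by most of B, and
-- almost all such u serve as starting points; or xᵢ has an out-neighbour rᵢ that dominates
-- many vertices of B, and xᵢ rᵢ b is a detour into B.  The rᵢ are fixed first and deleted
-- together with the xᵢ, and Menger's theorem provides the walks in what remains.
-- Minimality is replaced by descent: a failing step exhibits a shorter system of walks.

module Submission where

open import Defs
open import Level using (0ℓ)
open import Data.Bool.Base using (true; false)
import Data.Empty as Empty
open import Data.Fin.Base using (Fin; zero; suc)
import Data.Fin.Properties as Fin
open import Data.Fin.Subset
open import Data.Fin.Subset.Properties
open import Data.List.Base as List using (List; []; _∷_; _++_; length; take)
open import Data.List.Extrema.Nat using (argmax; argmax-all; f[xs]≤f[argmax])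
open import Data.List.Properties using (length-tabulate; length-++; length-take)
import Data.List.Membership.DecPropositional as DecMembership
import Data.List.Membership.Propositional as List
open import Data.List.Membership.Propositional.Properties
  using (∈-tabulate⁺; ∈-tabulate⁻; ∈-++⁺ˡ; ∈-++⁺ʳ; ∈-++⁻; ∈-concat⁺′; ∈-filter⁺; ∈-allFin)
open import Data.List.Relation.Unary.All as All using ([]; _∷_)
open import Data.List.Relation.Unary.All.Properties using (all-filter; ¬Any⇒All¬)
open import Data.List.Relation.Unary.AllPairs using ([]; _∷_)
open import Data.List.Relation.Unary.Any using (here; there)
open import Data.List.Relation.Unary.Unique.Propositional using (Unique)
open import Data.List.Relation.Binary.Disjoint.Propositional using (Disjoint)
open import Data.Nat.Base using (ℕ; zero; suc; _+_; _*_; _^_; _≤_; _<_; _⊓_; z≤n; s≤s)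
open import Data.Nat.Induction using (<-wellFounded)
open import Data.Nat.Properties
open import Data.Nat.Solver using (module +-*-Solver)
open import Data.Product.Base using (Σ-syntax; ∃₂; ∃-syntax; _×_; _,_; proj₁; proj₂; map₂)
open import Data.Sum.Base using (_⊎_; inj₁; inj₂; [_,_]′; swap)
open import Data.Vec.Base using ([]; _∷_; foldr₁; tabulate; here; there)
open import Data.Vec.Functional using (updateAt)
open import Data.Vec.Functional.Properties using (updateAt-updates; updateAt-minimal)
open import Data.Vec.Properties using (lookup∘tabulate; []=⇒lookup; lookup⇒[]=)
open import Function.Base using (_∘_; id; case_of_)
open import Function.Definitions using (Injective)
open import Induction.WellFounded using (Acc; acc)
open import Relation.Binary.Construct.Closure.ReflexiveTransitive using (Star; ε; _◅_; _◅◅_)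
open import Relation.Binary.Core using (Rel)
open import Relation.Binary.Definitions using (DecidableEquality) renaming (Decidable to Decidable₂)
open import Relation.Binary.PropositionalEquality
open import Relation.Nullary using (¬_; Dec; yes; no; does; contradiction)
open import Relation.Nullary.Decidable using (dec-true; _×-dec_; _⊎-dec_; _→-dec_; ¬?; decidable-stable)
open import Relation.Unary using (Decidable)
open import Algebra.Properties.Monoid.Sum +-0-monoid using (sum)

private variable
  n m k : ℕ

-- Finite sets and sums

⟪_⟫ : {P : Fin n → Set} → Decidable P → Subset n
⟪ P? ⟫ = tabulate (does ∘ P?)

module _ {P : Fin n → Set} (P? : Decidable P) where

  ∈⟪⟫⁺ : ∀ {x} → P x → x ∈ ⟪ P? ⟫
  ∈⟪⟫⁺ {x} px = lookup⇒[]= x _ (trans (lookup∘tabulate (does ∘ P?) x) (dec-true (P? x) px))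

  ∈⟪⟫⁻ : ∀ {x} → x ∈ ⟪ P? ⟫ → P x
  ∈⟪⟫⁻ {x} x∈ with P? x | trans (sym (lookup∘tabulate (does ∘ P?) x)) ([]=⇒lookup x∈)
  ... | yes px | _ = px

∣p∪q∣+∣p∩q∣≡∣p∣+∣q∣ : (p q : Subset n) → ∣ p ∪ q ∣ + ∣ p ∩ q ∣ ≡ ∣ p ∣ + ∣ q ∣
∣p∪q∣+∣p∩q∣≡∣p∣+∣q∣ []          []          = refl
∣p∪q∣+∣p∩q∣≡∣p∣+∣q∣ (false ∷ p) (false ∷ q) = ∣p∪q∣+∣p∩q∣≡∣p∣+∣q∣ p q
∣p∪q∣+∣p∩q∣≡∣p∣+∣q∣ (false ∷ p) (true  ∷ q) =
  trans (cong suc (∣p∪q∣+∣p∩q∣≡∣p∣+∣q∣ p q)) (sym (+-suc ∣ p ∣ ∣ q ∣))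
∣p∪q∣+∣p∩q∣≡∣p∣+∣q∣ (true  ∷ p) (false ∷ q) = cong suc (∣p∪q∣+∣p∩q∣≡∣p∣+∣q∣ p q)
∣p∪q∣+∣p∩q∣≡∣p∣+∣q∣ (true  ∷ p) (true  ∷ q) = cong suc
  (trans (+-suc ∣ p ∪ q ∣ ∣ p ∩ q ∣)
    (trans (cong suc (∣p∪q∣+∣p∩q∣≡∣p∣+∣q∣ p q)) (sym (+-suc ∣ p ∣ ∣ q ∣))))

∣p∪q∣≤∣p∣+∣q∣ : (p q : Subset n) → ∣ p ∪ q ∣ ≤ ∣ p ∣ + ∣ q ∣
∣p∪q∣≤∣p∣+∣q∣ p q = subst (∣ p ∪ q ∣ ≤_) (∣p∪q∣+∣p∩q∣≡∣p∣+∣q∣ p q) (m≤m+n _ _)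

disjoint⇒∣p∣+∣q∣≤∣p∪q∣ : (p q : Subset n) → (∀ {x} → x ∈ p → x ∉ q) → ∣ p ∣ + ∣ q ∣ ≤ ∣ p ∪ q ∣
disjoint⇒∣p∣+∣q∣≤∣p∪q∣ {n} p q p∩q=∅ = ≤-reflexive (begin
  ∣ p ∣ + ∣ q ∣          ≡⟨ ∣p∪q∣+∣p∩q∣≡∣p∣+∣q∣ p q ⟨
  ∣ p ∪ q ∣ + ∣ p ∩ q ∣  ≡⟨ cong (λ r → ∣ p ∪ q ∣ + ∣ r ∣) (Empty-unique λ (x , x∈) →
                              p∩q=∅ (p∩q⊆p p q x∈) (p∩q⊆q p q x∈)) ⟩
  ∣ p ∪ q ∣ + ∣ ⊥ {n} ∣  ≡⟨ cong (∣ p ∪ q ∣ +_) (∣⊥∣≡0 n) ⟩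
  ∣ p ∪ q ∣ + 0          ≡⟨ +-identityʳ _ ⟩
  ∣ p ∪ q ∣              ∎)
  where open ≡-Reasoning

x∈p─q⇒x∉q : ∀ {x} (p q : Subset n) → x ∈ p ─ q → x ∉ q
x∈p─q⇒x∉q (_ ∷ p) (true  ∷ q) (there x∈) (there x∈q) = x∈p─q⇒x∉q p q x∈ x∈q
x∈p─q⇒x∉q (_ ∷ p) (false ∷ q) (there x∈) (there x∈q) = x∈p─q⇒x∉q p q x∈ x∈q

p⊆q∪r⇒∣p∣≤∣q∣+∣r∣ : {p : Subset n} (q r : Subset n) →
  (∀ {x} → x ∈ p → x ∈ q ⊎ x ∈ r) → ∣ p ∣ ≤ ∣ q ∣ + ∣ r ∣
p⊆q∪r⇒∣p∣≤∣q∣+∣r∣ q r p⊆ = ≤-trans (p⊆q⇒∣p∣≤∣q∣ (x∈p∪q⁺ {p = q} {r} ∘ p⊆)) (∣p∪q∣≤∣p∣+∣q∣ q r)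

∣p∣≤∣p─q∣+∣q∣ : (p q : Subset n) → ∣ p ∣ ≤ ∣ p ─ q ∣ + ∣ q ∣
∣p∣≤∣p─q∣+∣q∣ p q = p⊆q∪r⇒∣p∣≤∣q∣+∣r∣ (p ─ q) q λ {x} x∈p → case x ∈? q of λ where
  (yes x∈q) → inj₂ x∈q
  (no  x∉q) → inj₁ (x∈p∧x∉q⇒x∈p─q x∈p x∉q)

∣p∣≤1+∣p-x∣ : (p : Subset n) (x : Fin n) → ∣ p ∣ ≤ suc ∣ p - x ∣
∣p∣≤1+∣p-x∣ p x = begin
  ∣ p ∣                  ≤⟨ ∣p∣≤∣p─q∣+∣q∣ p ⁅ x ⁆ ⟩
  ∣ p - x ∣ + ∣ ⁅ x ⁆ ∣  ≡⟨ cong (∣ p - x ∣ +_) (∣⁅x⁆∣≡1 x) ⟩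
  ∣ p - x ∣ + 1          ≡⟨ +-comm _ 1 ⟩
  suc ∣ p - x ∣          ∎
  where open ≤-Reasoning

0<∣p∣⇒Nonempty : {p : Subset n} → 0 < ∣ p ∣ → Nonempty p
0<∣p∣⇒Nonempty {n} {p} 0<∣p∣ = decidable-stable (nonempty? p) λ empty →
  <-irrefl (sym (trans (cong ∣_∣ (Empty-unique empty)) (∣⊥∣≡0 n))) 0<∣p∣

∣q∣<∣p∣⇒∃∈p∖q : {p q : Subset n} → ∣ q ∣ < ∣ p ∣ → ∃[ x ] x ∈ p × x ∉ q
∣q∣<∣p∣⇒∃∈p∖q {p = p} {q} ∣q∣<∣p∣ =
  let x , x∈ = 0<∣p∣⇒Nonempty (+-cancelʳ-< (∣ q ∣) 0 (∣ p ─ q ∣) (<-≤-trans ∣q∣<∣p∣ (∣p∣≤∣p─q∣+∣q∣ p q)))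
  in x , p─q⊆p p q x∈ , x∈p─q⇒x∉q p q x∈

fromList : List (Fin n) → Subset n
fromList []       = ⊥
fromList (x ∷ xs) = ⁅ x ⁆ ∪ fromList xs

∈-fromList⁺ : ∀ {x} {xs : List (Fin n)} → x List.∈ xs → x ∈ fromList xs
∈-fromList⁺ {xs = x ∷ xs} (here refl) = p⊆p∪q _ (x∈⁅x⁆ x)
∈-fromList⁺ {xs = y ∷ xs} (there x∈)  = q⊆p∪q ⁅ y ⁆ _ (∈-fromList⁺ x∈)

∈-fromList⁻ : ∀ {x} (xs : List (Fin n)) → x ∈ fromList xs → x List.∈ xs
∈-fromList⁻ []       x∈ = contradiction x∈ ∉⊥
∈-fromList⁻ (y ∷ xs) x∈ with x∈p∪q⁻ ⁅ y ⁆ _ x∈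
... | inj₁ x∈y  = here (x∈⁅y⁆⇒x≡y y x∈y)
... | inj₂ x∈xs = there (∈-fromList⁻ xs x∈xs)

∣fromList∣≤length : (xs : List (Fin n)) → ∣ fromList xs ∣ ≤ List.length xs
∣fromList∣≤length {n} []       = ≤-reflexive (∣⊥∣≡0 n)
∣fromList∣≤length     (x ∷ xs) = ≤-trans (∣p∪q∣≤∣p∣+∣q∣ ⁅ x ⁆ _)
  (+-mono-≤ (≤-reflexive (∣⁅x⁆∣≡1 x)) (∣fromList∣≤length xs))

length<∣p∣⇒∃∈p∖xs : {p : Subset n} (xs : List (Fin n)) → List.length xs < ∣ p ∣ →
  ∃[ x ] x ∈ p × x List.∉ xs
length<∣p∣⇒∃∈p∖xs xs lt =
  let x , x∈p , x∉ = ∣q∣<∣p∣⇒∃∈p∖q (≤-<-trans (∣fromList∣≤length xs) lt)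
  in x , x∈p , x∉ ∘ ∈-fromList⁺

sum-mono-≤ : {f g : Fin n → ℕ} → (∀ i → f i ≤ g i) → sum f ≤ sum g
sum-mono-≤ {zero}  f≤g = z≤n
sum-mono-≤ {suc n} f≤g = +-mono-≤ (f≤g zero) (sum-mono-≤ (f≤g ∘ suc))

sum-mono-< : {f g : Fin n → ℕ} → (∀ i → f i ≤ g i) → ∀ j → f j < g j → sum f < sum g
sum-mono-< f≤g zero    lt = +-mono-<-≤ lt (sum-mono-≤ (f≤g ∘ suc))
sum-mono-< f≤g (suc j) lt = +-mono-≤-< (f≤g zero) (sum-mono-< (f≤g ∘ suc) j lt)

-- Hall's theorem

module Hall (A₀ : Subset n) where

  -- A violation of Hall's condition. `G` may be any set containing the neighbourhood of `A`, so
  -- that two obstructions are uncrossed by plain unions and intersections.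
  Obstruction : (Fin n → Subset m) → Subset n → Subset m → Set
  Obstruction Γ A G = A ⊆ A₀ × (∀ v → v ∈ A → Γ v ⊆ G) × ∣ G ∣ < ∣ A ∣

  Feasible : (Fin n → Subset m) → Set
  Feasible Γ = ∀ A G → ¬ Obstruction Γ A G

  Transversal : (Fin n → Subset m) → Set
  Transversal {m} Γ = Σ[ φ ∈ (∀ v → v ∈ A₀ → Fin m) ]
    (∀ v v∈ → φ v v∈ ∈ Γ v) × (∀ v w v∈ w∈ → φ v v∈ ≡ φ w w∈ → v ≡ w)

  obstruction? : (Γ : Fin n → Subset m) → Dec (∃₂ (Obstruction Γ))
  obstruction? Γ = anySubset? λ A → anySubset? λ G →
    A ⊆? A₀ ×-dec Fin.all? (λ v → v ∈? A →-dec Γ v ⊆? G) ×-dec ∣ G ∣ <? ∣ A ∣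

  module _ (Γ : Fin n → Subset m) (v : Fin n) where

    remove : Fin m → Fin n → Subset m
    remove g = updateAt Γ v (_- g)

    remove-there : ∀ g {w} → w ≢ v → remove g w ≡ Γ w
    remove-there g {w} w≢v = updateAt-minimal w v Γ w≢v

    ∈-remove : ∀ {g h w} → h ∈ Γ w → w ≢ v ⊎ h ≢ g → h ∈ remove g w
    ∈-remove {g} {h} h∈ (inj₁ w≢v) = subst (h ∈_) (sym (remove-there g w≢v)) h∈
    ∈-remove {g} {h} {w} h∈ (inj₂ h≢g) with w Fin.≟ v
    ... | yes refl = subst (h ∈_) (sym (updateAt-updates v Γ)) (x∈p∧x≢y⇒x∈p-y h∈ h≢g)
    ... | no w≢v   = subst (h ∈_) (sym (remove-there g w≢v)) h∈

    remove-⊆ : ∀ g w → remove g w ⊆ Γ w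
    remove-⊆ g w with w Fin.≟ v
    ... | yes refl = λ h∈ → p─q⊆p (Γ v) ⁅ g ⁆ (subst (_ ∈_) (updateAt-updates v Γ) h∈)
    ... | no w≢v   = λ h∈ → subst (_ ∈_) (remove-there g w≢v) h∈

    remove-shrinks : ∀ {g} → g ∈ Γ v → sum (∣_∣ ∘ remove g) < sum (∣_∣ ∘ Γ)
    remove-shrinks {g} g∈ = sum-mono-< (λ w → p⊆q⇒∣p∣≤∣q∣ (remove-⊆ g w)) v
      (subst (λ p → ∣ p ∣ < ∣ Γ v ∣) (sym (updateAt-updates v Γ)) (x∈p⇒∣p-x∣<∣p∣ g∈))

    -- Uncrossing: if deleting g₁ and deleting g₂ from Γ v both create obstructions, then
    -- their union, or their intersection without v, already obstructs Γ.
    remove-feasible : Feasible Γ → ∀ {g₁ g₂} → g₁ ≢ g₂ →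
      ∃₂ (Obstruction (remove g₁)) → ¬ ∃₂ (Obstruction (remove g₂))
    remove-feasible feas {g₁} {g₂} g₁≢g₂ (A₁ , G₁ , ob₁@(A₁⊆ , Γ⊆G₁ , lt₁)) (A₂ , G₂ , ob₂@(A₂⊆ , Γ⊆G₂ , lt₂)) =
      <-irrefl refl (begin-strict
        ∣ A₁ ∣ + ∣ A₂ ∣                    ≡⟨ ∣p∪q∣+∣p∩q∣≡∣p∣+∣q∣ A₁ A₂ ⟨
        -- Dropping `v` from the intersection costs one; the strict inequalities `lt₁` and `lt₂`
        -- gain two.
        ∣ A₁ ∪ A₂ ∣ + ∣ A₁ ∩ A₂ ∣          ≤⟨ +-mono-≤ union (≤-trans (∣p∣≤1+∣p-x∣ (A₁ ∩ A₂) v) (s≤s inter)) ⟩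
        ∣ G₁ ∪ G₂ ∣ + suc ∣ G₁ ∩ G₂ ∣      ≡⟨ +-suc _ _ ⟩
        suc (∣ G₁ ∪ G₂ ∣ + ∣ G₁ ∩ G₂ ∣)    ≡⟨ cong suc (∣p∪q∣+∣p∩q∣≡∣p∣+∣q∣ G₁ G₂) ⟩
        suc (∣ G₁ ∣ + ∣ G₂ ∣)              ≡⟨ +-suc ∣ G₁ ∣ ∣ G₂ ∣ ⟨
        ∣ G₁ ∣ + suc ∣ G₂ ∣                <⟨ +-mono-<-≤ lt₁ lt₂ ⟩
        ∣ A₁ ∣ + ∣ A₂ ∣                    ∎)
      where
      open ≤-Reasoning
      -- Only the set at `v` has changed, so an obstruction missing `v` would obstruct `Γ` itself.
      v∈ : ∀ {g A G} → Obstruction (remove g) A G → v ∈ A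
      v∈ {g} {A} {G} (A⊆ , Γ⊆G , lt) = decidable-stable (v ∈? A) λ v∉A → feas A G
        (A⊆ , (λ w w∈ h∈ → Γ⊆G w w∈ (∈-remove h∈ (inj₁ λ { refl → v∉A w∈ }))) , lt)
      -- The one neighbour of `v` lost to the first deletion survives the second, because the
      -- deleted elements differ.
      cover : ∀ {A g g′ G G′} → Obstruction (remove g) A G → (∀ {h} → h ∈ remove g′ v → h ∈ G′) → g ≢ g′ →
        ∀ w → w ∈ A → ∀ {h} → h ∈ Γ w → h ∈ G ⊎ h ∈ G′
      cover {g = g} (_ , Γ⊆G , _) v⊆G′ g≢g′ w w∈A {h} h∈ with w Fin.≟ v | h Fin.≟ g
      ... | no w≢v   | _        = inj₁ (Γ⊆G w w∈A (∈-remove h∈ (inj₁ w≢v)))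
      ... | yes refl | no h≢g   = inj₁ (Γ⊆G w w∈A (∈-remove h∈ (inj₂ h≢g)))
      ... | yes refl | yes refl = inj₂ (v⊆G′ (∈-remove h∈ (inj₂ g≢g′)))
      union : ∣ A₁ ∪ A₂ ∣ ≤ ∣ G₁ ∪ G₂ ∣
      union = ≮⇒≥ λ lt → feas (A₁ ∪ A₂) (G₁ ∪ G₂)
        ( [ A₁⊆ , A₂⊆ ]′ ∘ x∈p∪q⁻ A₁ A₂
        , (λ w w∈ h∈ → x∈p∪q⁺ (case x∈p∪q⁻ A₁ A₂ w∈ of λ where
            (inj₁ w∈₁) → cover ob₁ (Γ⊆G₂ v (v∈ ob₂)) g₁≢g₂ w w∈₁ h∈
            (inj₂ w∈₂) → swap (cover ob₂ (Γ⊆G₁ v (v∈ ob₁)) (g₁≢g₂ ∘ sym) w w∈₂ h∈)))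
        , lt)
      inter : ∣ A₁ ∩ A₂ - v ∣ ≤ ∣ G₁ ∩ G₂ ∣
      inter = ≮⇒≥ λ lt → feas (A₁ ∩ A₂ - v) (G₁ ∩ G₂)
        ( A₁⊆ ∘ p∩q⊆p A₁ A₂ ∘ p─q⊆p (A₁ ∩ A₂) ⁅ v ⁆
        , (λ w w∈ h∈ → let w∈₁ , w∈₂ = x∈p∩q⁻ A₁ A₂ (p─q⊆p (A₁ ∩ A₂) ⁅ v ⁆ w∈)
                           w≢v = x∉⁅y⁆⇒x≢y (x∈p─q⇒x∉q (A₁ ∩ A₂) ⁅ v ⁆ w∈)
                       in x∈p∩q⁺ (Γ⊆G₁ w w∈₁ (∈-remove h∈ (inj₁ w≢v)) , Γ⊆G₂ w w∈₂ (∈-remove h∈ (inj₁ w≢v))))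
        , lt)

  -- While some set over `A₀` has two elements, `remove-feasible` shows that one of them can be
  -- deleted safely. Once all have at most one, feasibility makes these elements exist and differ.
  hall : (Γ : Fin n → Subset m) → Feasible Γ → Transversal Γ
  hall {m} Γ feas = go Γ feas (<-wellFounded _)
    where
    go : (Γ : Fin n → Subset m) → Feasible Γ → Acc _<_ (sum (∣_∣ ∘ Γ)) → Transversal Γ
    go Γ feas (acc rec) with
      Fin.any? (λ v → v ∈? A₀ ×-dec Fin.any? (λ g₁ → Fin.any? (λ g₂ →
        g₁ ∈? Γ v ×-dec g₂ ∈? Γ v ×-dec ¬? (g₁ Fin.≟ g₂))))
    ... | yes (v , v∈ , g₁ , g₂ , g₁∈ , g₂∈ , g₁≢g₂) =
      case obstruction? (remove Γ v g₁) of λ where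
        (no ¬ob₁) → descend g₁∈ ¬ob₁
        (yes ob₁) → descend g₂∈ (remove-feasible Γ v feas g₁≢g₂ ob₁)
      where
      descend : ∀ {g} → g ∈ Γ v → ¬ ∃₂ (Obstruction (remove Γ v g)) → Transversal Γ
      descend {g} g∈ ¬ob =
        let φ , φ∈ , φ-inj = go (remove Γ v g) (λ A G ob → ¬ob (A , G , ob)) (rec (remove-shrinks Γ v g∈))
        in φ , (λ w w∈ → remove-⊆ Γ v g w (φ∈ w w∈)) , φ-inj
    ... | no single = (λ v v∈ → proj₁ (image v v∈)) , (λ v v∈ → proj₂ (image v v∈)) , injective
      where
      Γ⊆⁅⁆ : ∀ {v g} → v ∈ A₀ → g ∈ Γ v → Γ v ⊆ ⁅ g ⁆
      Γ⊆⁅⁆ {v} {g} v∈ g∈ {h} h∈ = subst (_∈ ⁅ g ⁆) (sym (decidable-stable (h Fin.≟ g) λ h≢g →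
        single (v , v∈ , h , g , h∈ , g∈ , h≢g))) (x∈⁅x⁆ g)
      image : ∀ v → v ∈ A₀ → Nonempty (Γ v)
      image v v∈ = 0<∣p∣⇒Nonempty (≰⇒> λ ∣Γv∣≤0 → feas ⁅ v ⁆ (Γ v)
        ( (λ w∈ → subst (_∈ A₀) (sym (x∈⁅y⁆⇒x≡y v w∈)) v∈)
        , (λ w w∈ → subst (λ u → _ ∈ Γ u) (x∈⁅y⁆⇒x≡y v w∈))
        , subst (∣ Γ v ∣ <_) (sym (∣⁅x⁆∣≡1 v)) (s≤s ∣Γv∣≤0) ))
      injective : ∀ v w v∈ w∈ → proj₁ (image v v∈) ≡ proj₁ (image w w∈) → v ≡ w
      injective v w v∈ w∈ eq = decidable-stable (v Fin.≟ w) λ v≢w →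
        let g , g∈v = image v v∈
            g∈w = subst (_∈ Γ w) (sym eq) (proj₂ (image w w∈))
        in feas (⁅ v ⁆ ∪ ⁅ w ⁆) ⁅ g ⁆
        ( [ (λ u∈ → subst (_∈ A₀) (sym (x∈⁅y⁆⇒x≡y v u∈)) v∈)
          , (λ u∈ → subst (_∈ A₀) (sym (x∈⁅y⁆⇒x≡y w u∈)) w∈) ]′ ∘ x∈p∪q⁻ ⁅ v ⁆ ⁅ w ⁆
        , (λ u u∈ h∈ → case x∈p∪q⁻ ⁅ v ⁆ ⁅ w ⁆ u∈ of λ where
            (inj₁ u∈v) → Γ⊆⁅⁆ v∈ g∈v (subst (λ u → _ ∈ Γ u) (x∈⁅y⁆⇒x≡y v u∈v) h∈)
            (inj₂ u∈w) → Γ⊆⁅⁆ w∈ g∈w (subst (λ u → _ ∈ Γ u) (x∈⁅y⁆⇒x≡y w u∈w) h∈))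
        , ≤-trans (≤-reflexive (cong suc (trans (∣⁅x⁆∣≡1 g) (sym (∣⁅x⁆∣≡1 v)))))
            (≤-trans (≤-reflexive (trans (+-comm 1 ∣ ⁅ v ⁆ ∣) (cong (∣ ⁅ v ⁆ ∣ +_) (sym (∣⁅x⁆∣≡1 w)))))
              (disjoint⇒∣p∣+∣q∣≤∣p∪q∣ ⁅ v ⁆ ⁅ w ⁆ λ u∈v u∈w →
                v≢w (trans (sym (x∈⁅y⁆⇒x≡y v u∈v)) (x∈⁅y⁆⇒x≡y w u∈w)))) )

-- Walks

module Walk {V : Set} (_⟶_ : Rel V 0ℓ) where

  infix 4 _on_
  _on_ : ∀ {u v} → V → Star _⟶_ u v → Set
  z on w = z List.∈ vertices _⟶_ w

  order : ∀ {u v} → Star _⟶_ u v → ℕ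
  order = length ∘ vertices _⟶_

  source-on : ∀ {u v} (w : Star _⟶_ u v) → u on w
  source-on ε       = here refl
  source-on (_ ◅ _) = here refl

  target-on : ∀ {u v} (w : Star _⟶_ u v) → v on w
  target-on ε       = here refl
  target-on (_ ◅ w) = there (target-on w)

  on-◅◅⁻ : ∀ {u v z x} (w : Star _⟶_ u v) (w′ : Star _⟶_ v z) → x on w ◅◅ w′ → x on w ⊎ x on w′
  on-◅◅⁻ ε       w′ x∈         = inj₂ x∈
  on-◅◅⁻ (_ ◅ w) w′ (here eq)  = inj₁ (here eq)
  on-◅◅⁻ (_ ◅ w) w′ (there x∈) = [ inj₁ ∘ there , inj₂ ]′ (on-◅◅⁻ w w′ x∈)

  order-◅◅ : ∀ {u v z} (w : Star _⟶_ u v) (w′ : Star _⟶_ v z) → suc (order (w ◅◅ w′)) ≡ order w + order w′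
  order-◅◅ ε       w′ = refl
  order-◅◅ (_ ◅ w) w′ = cong suc (order-◅◅ w w′)

  -- Prepares shortcuts: beyond the first `t` vertices, jumping to `z` saves at least `t` vertices,
  -- which pays for a detour.
  suffix : ∀ t {u v z} (w : Star _⟶_ u v) → z on w →
    z List.∈ take t (vertices _⟶_ w) ⊎
    Σ[ w′ ∈ Star _⟶_ z v ] t + order w′ ≤ order w × (∀ {x} → x on w′ → x on w)
  suffix zero    ε       (here refl) = inj₂ (ε , ≤-refl , id)
  suffix zero    (e ◅ w) (here refl) = inj₂ (e ◅ w , ≤-refl , id)
  suffix zero    (e ◅ w) (there z∈)  with suffix zero w z∈
  ... | inj₂ (w′ , le , ⊆) = inj₂ (w′ , m≤n⇒m≤1+n le , there ∘ ⊆)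
  suffix (suc t) ε       (here refl) = inj₁ (here refl)
  suffix (suc t) (e ◅ w) (here refl) = inj₁ (here refl)
  suffix (suc t) (e ◅ w) (there z∈)  with suffix t w z∈
  ... | inj₁ z∈′           = inj₁ (there z∈′)
  ... | inj₂ (w′ , le , ⊆) = inj₂ (w′ , s≤s le , there ∘ ⊆)

  crossing : {P : V → Set} → (∀ z → Dec (P z)) → ∀ {u v} (w : Star _⟶_ u v) → ¬ P u → P v →
    ∃₂ λ c a → c ⟶ a × c on w × ¬ P c × P a
  crossing P? ε ¬Pu Pv = contradiction Pv ¬Pu
  crossing P? (_◅_ {j = z} e w) ¬Pu Pv with P? z
  ... | yes Pz = _ , z , e , here refl , ¬Pu , Pz
  ... | no ¬Pz = let c , a , c⟶a , c∈ , ¬Pc , Pa = crossing P? w ¬Pz Pv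
                 in c , a , c⟶a , there c∈ , ¬Pc , Pa

  unique-suffix : ∀ {u v z} (w : Star _⟶_ u v) → Unique (vertices _⟶_ w) → z on w →
    Σ[ p ∈ Path _⟶_ z v ] (∀ {x} → x on Path.walk p → x on w)
  unique-suffix ε       uniq       (here refl) = record { walk = ε ; simple = uniq } , id
  unique-suffix (e ◅ w) uniq       (here refl) = record { walk = e ◅ w ; simple = uniq } , id
  unique-suffix (e ◅ w) (_ ∷ uniq) (there z∈)  = map₂ (λ ⊆w {x} x∈ → there (⊆w x∈)) (unique-suffix w uniq z∈)

  -- Loop erasure. The containment carries disjointness over from walks, so loops can be erased at
  -- the very end.
  walk⇒path : DecidableEquality V → ∀ {u v} (w : Star _⟶_ u v) →
    Σ[ p ∈ Path _⟶_ u v ] (∀ {x} → x on Path.walk p → x on w)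
  walk⇒path _≟_ ε = record { walk = ε ; simple = [] ∷ [] } , id
  walk⇒path _≟_ {u} (e ◅ w) with walk⇒path _≟_ w
  ... | p , p⊆w with DecMembership._∈?_ _≟_ u (vertices _⟶_ (Path.walk p))
  ...   | yes u∈p = map₂ (λ ⊆p {x} x∈ → there (p⊆w (⊆p x∈))) (unique-suffix (Path.walk p) (Path.simple p) u∈p)
  ...   | no  u∉p = record { walk = e ◅ Path.walk p ; simple = ¬Any⇒All¬ _ u∉p ∷ Path.simple p }
                  , λ { (here eq) → here eq ; (there x∈) → there (p⊆w x∈) }

-- Menger's theorem

module Linkage {n k : ℕ} (_⟶_ : Rel (Fin n) 0ℓ) (B D : Subset n) (y : Fin k → Fin n) where
  open Walk _⟶_

  record System : Set where
    field
      start    : Fin k → Fin n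
      start∈B  : ∀ j → start j ∈ B
      walk     : ∀ j → Star _⟶_ (start j) (y j)
      avoids   : ∀ j {v} → v on walk j → v ∉ D
      disjoint : ∀ i j {v} → v on walk i → v on walk j → i ≡ j

  -- Hall's theorem provides an injection φ of the vertices outside B ∪ D into those outside D
  -- and y, each v being sent to itself or to an in-neighbour; iterating φ from y j traces a
  -- walk backwards until it reaches B.
  module Menger (_⟶?_ : Decidable₂ _⟶_) (y-injective : Injective _≡_ _≡_ y) (y∉D : ∀ j → y j ∉ D)
    (∣D∣+k≤∣B∣ : ∣ D ∣ + k ≤ ∣ B ∣)
    (connected : ∀ S → ∣ S ∣ < ∣ D ∣ + k → ∀ {u v} → u ∉ S → v ∉ S →
                 Σ[ w ∈ Star _⟶_ u v ] (∀ {x} → x on w → x ∉ S)) where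

    Y A₀ : Subset n
    Y  = fromList (List.tabulate y)
    A₀ = ∁ (B ∪ D)

    ∣Y∣≤k : ∣ Y ∣ ≤ k
    ∣Y∣≤k = subst (∣ Y ∣ ≤_) (length-tabulate y) (∣fromList∣≤length (List.tabulate y))

    -- Forbidding `Y` keeps the iteration of `φ` from returning to any `y j`; allowing `w ≡ v`
    -- provides images for vertices off the walks.
    predecessor? : ∀ v w → Dec (w ∉ D × w ∉ Y × (w ≡ v ⊎ w ⟶ v))
    predecessor? v w = ¬? (w ∈? D) ×-dec ¬? (w ∈? Y) ×-dec (w Fin.≟ v ⊎-dec w ⟶? v)

    Γ : Fin n → Subset n
    Γ v = ⟪ predecessor? v ⟫

    open Hall A₀

    -- A violation `A`, `G` would give a separator `S` with fewer than `∣ D ∣ + k` vertices: a walk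
    -- outside `S` from `B` to `Y ∩ A` enters `A` by an edge `c ⟶ a`, and then `c` lies in `Γ a`,
    -- hence in `G ─ A`, a part of `S`.
    feasible : Feasible Γ
    feasible A G (A⊆A₀ , Γ⊆G , ∣G∣<∣A∣) =
      let c , a , c⟶a , c∈w , c∉A , a∈A = crossing (_∈? A) (proj₁ walk-b-t) b∉A t∈A
          c∉S = proj₂ walk-b-t c∈w
          c∉Y = λ c∈Y → c∉S (Y─A⊆S (x∈p∧x∉q⇒x∈p─q c∈Y c∉A))
      in c∉S (G─A⊆S (x∈p∧x∉q⇒x∈p─q (Γ⊆G a a∈A
           (∈⟪⟫⁺ (predecessor? a) (c∉S ∘ p⊆p∪q _ , c∉Y , inj₂ c⟶a))) c∉A))
      where
      S : Subset n
      S = D ∪ ((G ─ A) ∪ (Y ─ A))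
      G─A⊆S : G ─ A ⊆ S
      G─A⊆S = q⊆p∪q D _ ∘ p⊆p∪q (Y ─ A)
      Y─A⊆S : Y ─ A ⊆ S
      Y─A⊆S = q⊆p∪q D _ ∘ q⊆p∪q (G ─ A) _
      ∣p─A∣+∣p∩A∣≤∣p∣ : (p : Subset n) → ∣ p ─ A ∣ + ∣ p ∩ A ∣ ≤ ∣ p ∣
      ∣p─A∣+∣p∩A∣≤∣p∣ p = ≤-trans
        (disjoint⇒∣p∣+∣q∣≤∣p∪q∣ (p ─ A) (p ∩ A) λ x∈ x∈′ → x∈p─q⇒x∉q p A x∈ (p∩q⊆q p A x∈′))
        (p⊆q⇒∣p∣≤∣q∣ ([ p─q⊆p p A , p∩q⊆p p A ]′ ∘ x∈p∪q⁻ (p ─ A) (p ∩ A)))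
      -- A vertex of `A` outside `Y` belongs to its own `Γ`, hence to `G`.
      ∣A∣≤ : ∣ A ∣ ≤ ∣ Y ∩ A ∣ + ∣ G ∩ A ∣
      ∣A∣≤ = p⊆q∪r⇒∣p∣≤∣q∣+∣r∣ (Y ∩ A) (G ∩ A) λ {x} x∈A → case x ∈? Y of λ where
        (yes x∈Y) → inj₁ (x∈p∩q⁺ (x∈Y , x∈A))
        (no  x∉Y) → inj₂ (x∈p∩q⁺ (Γ⊆G x x∈A (∈⟪⟫⁺ (predecessor? x)
          (x∈∁p⇒x∉p (A⊆A₀ x∈A) ∘ q⊆p∪q B D , x∉Y , inj₁ refl)) , x∈A))
      ∣G─A∣<∣Y∩A∣ : ∣ G ─ A ∣ < ∣ Y ∩ A ∣
      ∣G─A∣<∣Y∩A∣ = +-cancelʳ-< (∣ G ∩ A ∣) _ _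
        (≤-<-trans (∣p─A∣+∣p∩A∣≤∣p∣ G) (<-≤-trans ∣G∣<∣A∣ ∣A∣≤))
      ∣S∣< : ∣ S ∣ < ∣ D ∣ + k
      ∣S∣< = begin-strict
        ∣ S ∣                              ≤⟨ ∣p∪q∣≤∣p∣+∣q∣ D _ ⟩
        ∣ D ∣ + ∣ (G ─ A) ∪ (Y ─ A) ∣      ≤⟨ +-monoʳ-≤ (∣ D ∣) (∣p∪q∣≤∣p∣+∣q∣ (G ─ A) (Y ─ A)) ⟩
        ∣ D ∣ + (∣ G ─ A ∣ + ∣ Y ─ A ∣)    <⟨ +-monoʳ-< (∣ D ∣) (+-monoˡ-< (∣ Y ─ A ∣) ∣G─A∣<∣Y∩A∣) ⟩
        ∣ D ∣ + (∣ Y ∩ A ∣ + ∣ Y ─ A ∣)    ≡⟨ cong (∣ D ∣ +_) (+-comm ∣ Y ∩ A ∣ _) ⟩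
        ∣ D ∣ + (∣ Y ─ A ∣ + ∣ Y ∩ A ∣)    ≤⟨ +-monoʳ-≤ (∣ D ∣) (≤-trans (∣p─A∣+∣p∩A∣≤∣p∣ Y) ∣Y∣≤k) ⟩
        ∣ D ∣ + k                          ∎
        where open ≤-Reasoning
      t∈Y∩A : Nonempty (Y ∩ A)
      t∈Y∩A = 0<∣p∣⇒Nonempty (≤-<-trans z≤n ∣G─A∣<∣Y∩A∣)
      t = proj₁ t∈Y∩A
      t∈A : t ∈ A
      t∈A = p∩q⊆q Y A (proj₂ t∈Y∩A)
      t∉S : t ∉ S
      t∉S t∈S = case x∈p∪q⁻ D _ t∈S of λ where
        (inj₁ t∈D) → x∈∁p⇒x∉p (A⊆A₀ t∈A) (q⊆p∪q B D t∈D)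
        (inj₂ t∈)  → [ (λ t∈ → x∈p─q⇒x∉q G A t∈ t∈A) , (λ t∈ → x∈p─q⇒x∉q Y A t∈ t∈A) ]′ (x∈p∪q⁻ (G ─ A) _ t∈)
      b∈B∖S : ∃[ b ] b ∈ B × b ∉ S
      b∈B∖S = ∣q∣<∣p∣⇒∃∈p∖q (<-≤-trans ∣S∣< ∣D∣+k≤∣B∣)
      b∉A : proj₁ b∈B∖S ∉ A
      b∉A b∈A = x∈∁p⇒x∉p (A⊆A₀ b∈A) (p⊆p∪q D (proj₁ (proj₂ b∈B∖S)))
      walk-b-t = connected S ∣S∣< (proj₂ (proj₂ b∈B∖S)) t∉S

    transversal : Transversal Γ
    transversal = hall Γ feasible

    φ : ∀ v → v ∈ A₀ → Fin n
    φ = proj₁ transversal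

    φ-spec : ∀ v v∈ → φ v v∈ ∉ D × φ v v∈ ∉ Y × (φ v v∈ ≡ v ⊎ φ v v∈ ⟶ v)
    φ-spec v v∈ = ∈⟪⟫⁻ (predecessor? v) (proj₁ (proj₂ transversal) v v∈)

    -- A relation rather than a function of time, since `φ` can be iterated only while the vertex
    -- stays in `A₀`.
    data Orbit (j : Fin k) : ℕ → Fin n → Set where
      base : Orbit j 0 (y j)
      next : ∀ {t v} → Orbit j t v → (v∈ : v ∈ A₀) → Orbit j (suc t) (φ v v∈)

    y≢φ : ∀ {j v v∈} → y j ≢ φ v v∈
    y≢φ {j} {v} {v∈} eq = proj₁ (proj₂ (φ-spec v v∈))
      (subst (_∈ Y) eq (∈-fromList⁺ (∈-tabulate⁺ j)))

    -- Both orbits are traced back through the injective `φ`. Its values avoid `Y`, so the two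
    -- arrive at their initial vertices simultaneously.
    orbit-injective : ∀ {i j s t u v} → Orbit i s u → Orbit j t v → u ≡ v → i ≡ j × s ≡ t
    orbit-injective base         base         eq = y-injective eq , refl
    orbit-injective base         (next _ _)   eq = contradiction eq y≢φ
    orbit-injective (next _ _)   base         eq = contradiction (sym eq) y≢φ
    orbit-injective (next o u∈)  (next o′ v∈) eq =
      map₂ (cong suc) (orbit-injective o o′ (proj₂ (proj₂ transversal) _ _ u∈ v∈ eq))

    orbit-prefix : ∀ {j t v} → Orbit j t v → ∀ {s} → s ≤ t → ∃[ u ] Orbit j s u
    orbit-prefix {t = t} o {s} s≤t with m≤n⇒m<n∨m≡n s≤t
    orbit-prefix o          _ | inj₂ refl      = _ , o
    orbit-prefix (next o _) _ | inj₁ (s≤s s≤t) = orbit-prefix o s≤t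

    orbit-bound : ∀ {j t v} → Orbit j t v → t < n
    orbit-bound {t = t} o = ≰⇒> λ n≤t →
      let visit = λ (s : Fin (suc t)) → orbit-prefix o (Fin.toℕ≤pred[n] s)
          s , s′ , s<s′ , eq = Fin.pigeonhole (s≤s n≤t) (proj₁ ∘ visit)
      in <⇒≢ s<s′ (proj₂ (orbit-injective (proj₂ (visit s)) (proj₂ (visit s′)) eq))

    OrbitWalk : Fin k → Set
    OrbitWalk j = ∃[ b ] b ∈ B × Σ[ w ∈ Star _⟶_ b (y j) ] (∀ {x} → x on w → x ∉ D × ∃[ s ] Orbit j s x)

    orbit-walk : ∀ j → OrbitWalk j
    orbit-walk j = go n base (+-identityʳ n) (y∉D j) ε λ { (here refl) → y∉D j , 0 , base }
      where
      go : ∀ fuel {t v} → Orbit j t v → fuel + t ≡ n → v ∉ D → (w : Star _⟶_ v (y j)) →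
           (∀ {x} → x on w → x ∉ D × ∃[ s ] Orbit j s x) → OrbitWalk j
      -- Here `t` equals `n`, but an orbit visits distinct vertices and so has fewer than `n` steps.
      go zero       o eq v∉D w inv = contradiction (orbit-bound o) (<-irrefl eq)
      go (suc fuel) {t} {v} o eq v∉D w inv with v ∈? B
      ... | yes v∈B = v , v∈B , w , inv
      ... | no  v∉B with x∉p⇒x∈∁p {p = B ∪ D} ([ v∉B , v∉D ]′ ∘ x∈p∪q⁻ B D)
      ...   | v∈A₀ with φ-spec v v∈A₀
      -- A fixed point would be a vertex visited at two successive times.
      ...     | _    , _ , inj₁ φv≡v =
                contradiction (proj₂ (orbit-injective (next o v∈A₀) o φv≡v)) 1+n≢n
      ...     | φv∉D , _ , inj₂ φv⟶v =
                go fuel (next o v∈A₀) (trans (+-suc fuel t) eq) φv∉D (φv⟶v ◅ w)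
                  λ { (here refl) → φv∉D , suc t , next o v∈A₀ ; (there x∈) → inv x∈ }

    menger : System
    menger = record
      { start    = proj₁ ∘ orbit-walk
      ; start∈B  = proj₁ ∘ proj₂ ∘ orbit-walk
      ; walk     = λ j → proj₁ (proj₂ (proj₂ (orbit-walk j)))
      ; avoids   = λ j v∈ → proj₁ (proj₂ (proj₂ (proj₂ (orbit-walk j))) v∈)
      ; disjoint = λ i j v∈i v∈j →
          let inv = λ l → proj₂ (proj₂ (proj₂ (orbit-walk l)))
          in proj₁ (orbit-injective (proj₂ (proj₂ (inv i v∈i))) (proj₂ (proj₂ (inv j v∈j))) refl)
      }

-- Vertices of largest value

maximiser : (d : Fin n → ℕ) (p : Subset n) → Nonempty p → ∃[ x ] x ∈ p × (∀ {y} → y ∈ p → d y ≤ d x)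
maximiser {n} d p (x , x∈p) =
  argmax d x xs , argmax-all d x∈p (all-filter (_∈? p) (List.allFin n)) ,
  λ {y} y∈p → All.lookup (f[xs]≤f[argmax] x xs) (∈-filter⁺ (_∈? p) (∈-allFin y) y∈p)
  where xs = List.filter (_∈? p) (List.allFin n)

-- Each round adds a maximiser of the complement, whose value earlier members already reach.
top-set : (d : Fin n → ℕ) → ∀ m → m ≤ n →
  Σ[ B ∈ Subset n ] ∣ B ∣ ≡ m × (∀ {b u} → b ∈ B → u ∉ B → d u ≤ d b)
top-set {n} d zero    _   = ⊥ , ∣⊥∣≡0 n , λ b∈ → contradiction b∈ ∉⊥
top-set {n} d (suc m) m<n =
  let B , ∣B∣≡m , B-top = top-set d m (<⇒≤ m<n)
      u , _ , u∉B = ∣q∣<∣p∣⇒∃∈p∖q {p = ⊤} {B} (subst₂ _<_ (sym ∣B∣≡m) (sym (∣⊤∣≡n n)) m<n)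
      x , x∈ , x-max = maximiser d (∁ B) (u , x∉p⇒x∈∁p u∉B)
  in B ∪ ⁅ x ⁆
   , ≤-antisym
       (≤-trans (∣p∪q∣≤∣p∣+∣q∣ B ⁅ x ⁆) (≤-reflexive (size x ∣B∣≡m)))
       (≤-trans (≤-reflexive (sym (size x ∣B∣≡m))) (disjoint⇒∣p∣+∣q∣≤∣p∪q∣ B ⁅ x ⁆ λ b∈B b∈x →
         x∈∁p⇒x∉p x∈ (subst (_∈ B) (x∈⁅y⁆⇒x≡y x b∈x) b∈B)))
   , λ {b} {v} b∈ v∉ → case x∈p∪q⁻ B ⁅ x ⁆ b∈ of λ where
       (inj₁ b∈B) → B-top b∈B (v∉ ∘ p⊆p∪q ⁅ x ⁆)
       (inj₂ b∈x) → subst (λ b → d v ≤ d b) (sym (x∈⁅y⁆⇒x≡y x b∈x)) (x-max (x∉p⇒x∈∁p (v∉ ∘ p⊆p∪q ⁅ x ⁆)))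
  where
  size : ∀ x {c} → c ≡ m → c + ∣ ⁅ x ⁆ ∣ ≡ suc m
  size x refl = trans (cong (_ +_) (∣⁅x⁆∣≡1 x)) (+-comm _ 1)

n<2^n : ∀ n → n < 2 ^ n
n<2^n zero    = s≤s z≤n
n<2^n (suc n) = begin-strict
  suc n          ≤⟨ n<2^n n ⟩
  2 ^ n          <⟨ m<m+n (2 ^ n) (m^n>0 2 n) ⟩
  2 ^ n + 2 ^ n  ≡⟨ cong (2 ^ n +_) (+-identityʳ _) ⟨
  2 ^ suc n      ∎
  where open ≤-Reasoning

-- Tournaments

module Tournament (T : Digraph n) (tournament : IsTournament T) where
  open Digraph T

  _⟶?_ : ∀ u v → Dec (u ⟶ v)
  u ⟶? v = v ∈? N⁺ u

  N⁻ : Fin n → Subset n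
  N⁻ v = ⟪ _⟶? v ⟫

  ∈N⁻⁺ : ∀ {u v} → u ⟶ v → u ∈ N⁻ v
  ∈N⁻⁺ {v = v} = ∈⟪⟫⁺ (_⟶? v)

  ∈N⁻⁻ : ∀ {u v} → u ∈ N⁻ v → u ⟶ v
  ∈N⁻⁻ {v = v} = ∈⟪⟫⁻ (_⟶? v)

  total : ∀ {u v} → u ≢ v → u ⟶ v ⊎ v ⟶ u
  total {u} {v} u≢v = [ inj₁ ∘ proj₁ , inj₂ ∘ proj₂ ]′ (tournament u v u≢v)

  neighbours : (A : Subset n) (v : Fin n) → ∣ A ∣ ≤ suc (∣ A ∩ N⁺ v ∣ + ∣ A ∩ N⁻ v ∣)
  neighbours A v = ≤-trans (∣p∣≤1+∣p-x∣ A v) (s≤s (p⊆q∪r⇒∣p∣≤∣q∣+∣r∣ (A ∩ N⁺ v) (A ∩ N⁻ v) λ {u} u∈ →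
    let u∈A = p─q⊆p A ⁅ v ⁆ u∈
    in case total (x∉⁅y⁆⇒x≢y (x∈p─q⇒x∉q A ⁅ v ⁆ u∈)) of λ where
         (inj₁ u⟶v) → inj₂ (x∈p∩q⁺ (u∈A , ∈N⁻⁺ u⟶v))
         (inj₂ v⟶u) → inj₁ (x∈p∩q⁺ (u∈A , v⟶u))))

  -- Take any `v` in `A`. If it has `2 ^ s` out-neighbours in `A`, the vertex found among them gains
  -- `v` as a further in-neighbour. Otherwise at least `2 ^ s`, hence more than `s`, vertices of `A`
  -- dominate `v`.
  large-indegree : ∀ s (A : Subset n) → 2 ^ s ≤ ∣ A ∣ → ∃[ u ] u ∈ A × s ≤ ∣ A ∩ N⁻ u ∣
  large-indegree zero    A 1≤∣A∣ = let u , u∈A = 0<∣p∣⇒Nonempty 1≤∣A∣ in u , u∈A , z≤n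
  large-indegree (suc s) A 2^≤∣A∣ with 0<∣p∣⇒Nonempty (≤-trans (m^n>0 2 (suc s)) 2^≤∣A∣)
  ... | v , v∈A with 2 ^ s ≤? ∣ A ∩ N⁺ v ∣
  ...   | yes 2^≤out =
            let u , u∈ , s≤ = large-indegree s (A ∩ N⁺ v) 2^≤out
                u∈A , v⟶u = x∈p∩q⁻ A (N⁺ v) u∈
            in u , u∈A , ≤-<-trans s≤ (p⊂q⇒∣p∣<∣q∣
                 ( (λ w∈ → let w∈′ , w∈N⁻ = x∈p∩q⁻ (A ∩ N⁺ v) (N⁻ u) w∈
                           in x∈p∩q⁺ (p∩q⊆p A (N⁺ v) w∈′ , w∈N⁻))
                 , v , x∈p∩q⁺ (v∈A , ∈N⁻⁺ v⟶u)
                 , λ v∈ → loopless v (p∩q⊆q A (N⁺ v) (p∩q⊆p (A ∩ N⁺ v) (N⁻ u) v∈)) ))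
  ...   | no 2^≰out = v , v∈A , ≤-trans (n<2^n s) (+-cancelˡ-≤ (2 ^ s) _ _ (begin
            2 ^ s + 2 ^ s                        ≡⟨ cong (2 ^ s +_) (+-identityʳ _) ⟨
            2 ^ suc s                            ≤⟨ 2^≤∣A∣ ⟩
            ∣ A ∣                                ≤⟨ neighbours A v ⟩
            suc (∣ A ∩ N⁺ v ∣) + ∣ A ∩ N⁻ v ∣    ≤⟨ +-monoˡ-≤ (∣ A ∩ N⁻ v ∣) (≰⇒> 2^≰out) ⟩
            2 ^ s + ∣ A ∩ N⁻ v ∣                 ∎))
          where open ≤-Reasoning

  -- Only the interior is to avoid `L`: the target will be the start of a walk of the system, and
  -- such starts belong to `L`.
  data ShortPath (L : List (Fin n)) (v b : Fin n) : Set where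
    one   : v ⟶ b → ShortPath L v b
    two   : ∀ {u} → v ⟶ u → u ⟶ b → u List.∉ L → ShortPath L v b
    three : ∀ {u w} → v ⟶ u → u ⟶ w → w ⟶ b → u List.∉ L → w List.∉ L → ShortPath L v b

  -- If every path v u w b meets L, then the in-neighbours of b outside L dominate the
  -- out-neighbours of v outside L, and one of the latter has larger in-degree than b.
  short-path : ∀ {B : Subset n} → (∀ {b u} → b ∈ B → u ∉ B → ∣ N⁻ u ∣ ≤ ∣ N⁻ b ∣) →
    ∀ {N} (L : List (Fin n)) → length L ≤ N →
    ∀ v {b} → ∣ B ∣ + N + 2 ^ suc N ≤ outdegree v → b ∈ B → ShortPath L v b
  short-path {B} B-top {N} L ∣L∣≤N v {b} large b∈B = search
    where
    open ≤-Reasoning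
    O I : Subset n
    -- Vertices of `B` are left out so that `B-top` applies to every `u` in `O`.
    O = N⁺ v ─ fromList L ─ B
    I = N⁻ b ─ fromList L
    ∣p∣≤∣p─L∣+N : (p : Subset n) → ∣ p ∣ ≤ ∣ p ─ fromList L ∣ + N
    ∣p∣≤∣p─L∣+N p = ≤-trans (∣p∣≤∣p─q∣+∣q∣ p (fromList L))
      (+-monoʳ-≤ (∣ p ─ fromList L ∣) (≤-trans (∣fromList∣≤length L) ∣L∣≤N))
    ∈─L⁻ : ∀ (p : Subset n) {u} → u ∈ p ─ fromList L → u ∈ p × u List.∉ L
    ∈─L⁻ p u∈ = p─q⊆p p (fromList L) u∈ , x∈p─q⇒x∉q p (fromList L) u∈ ∘ ∈-fromList⁺
    ∈O⁻ : ∀ {u} → u ∈ O → v ⟶ u × u List.∉ L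
    ∈O⁻ u∈ = ∈─L⁻ (N⁺ v) (p─q⊆p (N⁺ v ─ fromList L) B u∈)
    O-large : 2 ^ suc N ≤ ∣ O ∣
    O-large = +-cancelˡ-≤ (∣ B ∣ + N) _ _ (begin
      ∣ B ∣ + N + 2 ^ suc N              ≤⟨ large ⟩
      ∣ N⁺ v ∣                           ≤⟨ ∣p∣≤∣p─L∣+N (N⁺ v) ⟩
      ∣ N⁺ v ─ fromList L ∣ + N          ≤⟨ +-monoˡ-≤ N (∣p∣≤∣p─q∣+∣q∣ (N⁺ v ─ fromList L) B) ⟩
      ∣ O ∣ + ∣ B ∣ + N                  ≡⟨ +-assoc (∣ O ∣) (∣ B ∣) N ⟩
      ∣ O ∣ + (∣ B ∣ + N)                ≡⟨ +-comm (∣ O ∣) _ ⟩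
      ∣ B ∣ + N + ∣ O ∣                  ∎)
    search : ShortPath L v b
    search with v ⟶? b | Fin.any? (λ u → u ∈? O ×-dec u ⟶? b) | large-indegree (suc N) O O-large
    ... | yes v⟶b | _                     | _ = one v⟶b
    ... | no _    | yes (u , u∈O , u⟶b)   | _ = two (proj₁ (∈O⁻ u∈O)) u⟶b (proj₂ (∈O⁻ u∈O))
    ... | no _    | no O↛b                | u , u∈O , N<in with Fin.any? (λ w → w ∈? I ×-dec u ⟶? w)
    ...   | yes (w , w∈I , u⟶w) =
            three (proj₁ (∈O⁻ u∈O)) u⟶w (∈N⁻⁻ (proj₁ (∈─L⁻ (N⁻ b) w∈I))) (proj₂ (∈O⁻ u∈O)) (proj₂ (∈─L⁻ (N⁻ b) w∈I))
    ...   | no u↛I = contradiction (begin-strict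
            ∣ I ∣ + N                        <⟨ +-monoʳ-< (∣ I ∣) N<in ⟩
            ∣ I ∣ + ∣ O ∩ N⁻ u ∣             ≤⟨ disjoint⇒∣p∣+∣q∣≤∣p∪q∣ I (O ∩ N⁻ u) I∩O=∅ ⟩
            ∣ I ∪ (O ∩ N⁻ u) ∣               ≤⟨ p⊆q⇒∣p∣≤∣q∣ ([ I⊆N⁻u , p∩q⊆q O (N⁻ u) ]′ ∘ x∈p∪q⁻ I (O ∩ N⁻ u)) ⟩
            ∣ N⁻ u ∣                         ≤⟨ B-top b∈B (x∈p─q⇒x∉q (N⁺ v ─ fromList L) B u∈O) ⟩
            ∣ N⁻ b ∣                         ≤⟨ ∣p∣≤∣p─L∣+N (N⁻ b) ⟩
            ∣ I ∣ + N                        ∎) (<-irrefl refl)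
      where
      I⟶b : ∀ {w} → w ∈ I → w ⟶ b
      I⟶b w∈I = ∈N⁻⁻ (proj₁ (∈─L⁻ (N⁻ b) w∈I))
      I∩O=∅ : ∀ {w} → w ∈ I → w ∉ O ∩ N⁻ u
      I∩O=∅ w∈I w∈ = O↛b (_ , p∩q⊆p O (N⁻ u) w∈ , I⟶b w∈I)
      I⊆N⁻u : I ⊆ N⁻ u
      -- `w` dominates `b` and no vertex of `O` does, so `w` differs from `u`; since `u` dominates
      -- nothing in `I`, the edge runs from `w` to `u`.
      I⊆N⁻u {w} w∈I with total {w} {u} (λ { refl → O↛b (w , u∈O , I⟶b w∈I) })
      ... | inj₁ w⟶u = ∈N⁻⁺ w⟶u
      ... | inj₂ u⟶w = contradiction (w , w∈I , u⟶w) u↛I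

-- Greedy disjoint choice

-- `E` is an escape common to all choices: impossible for the relays, a shorter system for the
-- links. Each support chosen joins `used`, so later ones avoid it.
greedy : ∀ {k} {V E : Set} {A : Fin k → Set} (support : ∀ {i} → A i → List V) c N →
  (∀ i used → length used ≤ N → E ⊎ Σ[ a ∈ A i ] length (support a) ≤ c × Disjoint used (support a)) →
  ∀ used → length used + k * c ≤ N →
  E ⊎ Σ[ a ∈ (∀ i → A i) ] (∀ i → Disjoint used (support (a i))) ×
                           (∀ i j {v} → v List.∈ support (a i) → v List.∈ support (a j) → i ≡ j)
greedy {zero}  support c N choose used bound = inj₂ ((λ ()) , (λ ()) , λ ())
greedy {suc k} {A = A} support c N choose used bound with choose zero used (≤-trans (m≤m+n _ _) bound)
... | inj₁ e = inj₁ e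
... | inj₂ (a₀ , ∣a₀∣≤c , fresh₀) with
      greedy (λ {i} → support {suc i}) c N (choose ∘ suc) (support a₀ ++ used) (begin
        length (support a₀ ++ used) + k * c          ≡⟨ cong (_+ k * c) (length-++ (support a₀)) ⟩
        length (support a₀) + length used + k * c    ≤⟨ +-monoˡ-≤ (k * c) (+-monoˡ-≤ (length used) ∣a₀∣≤c) ⟩
        c + length used + k * c                      ≡⟨ cong (_+ k * c) (+-comm c (length used)) ⟩
        length used + c + k * c                      ≡⟨ +-assoc (length used) c (k * c) ⟩
        length used + suc k * c                      ≤⟨ bound ⟩
        N                                            ∎)
  where open ≤-Reasoning
...   | inj₁ e = inj₁ e
...   | inj₂ (a , fresh , owner) = inj₂ (a′ , fresh′ , owner′)
  where
  a′ : ∀ i → A i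
  a′ zero    = a₀
  a′ (suc i) = a i
  fresh′ : ∀ i → Disjoint used (support (a′ i))
  fresh′ zero    = fresh₀
  fresh′ (suc i) (v∈used , v∈a) = fresh i (∈-++⁺ʳ (support a₀) v∈used , v∈a)
  owner′ : ∀ i j {v} → v List.∈ support (a′ i) → v List.∈ support (a′ j) → i ≡ j
  owner′ zero    zero    _  _   = refl
  owner′ zero    (suc j) v∈ v∈′ = contradiction (∈-++⁺ˡ v∈ , v∈′) (fresh j)
  owner′ (suc i) zero    v∈ v∈′ = contradiction (∈-++⁺ˡ v∈′ , v∈) (fresh i)
  owner′ (suc i) (suc j) v∈ v∈′ = cong suc (owner i j v∈ v∈′)

length-concat-tabulate : ∀ {V : Set} {c} (f : Fin k → List V) → (∀ i → length (f i) ≤ c) →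
  length (List.concat (List.tabulate f)) ≤ k * c
length-concat-tabulate {zero}  f ∣f∣≤c = z≤n
length-concat-tabulate {suc k} f ∣f∣≤c = ≤-trans (≤-reflexive (length-++ (f zero)))
  (+-mono-≤ (∣f∣≤c zero) (length-concat-tabulate (f ∘ suc) (∣f∣≤c ∘ suc)))

-- Shortening a system

module Reroute {n k : ℕ} (_⟶_ : Rel (Fin n) 0ℓ) (B D : Subset n) (y : Fin k → Fin n) where
  open Walk _⟶_
  open Linkage _⟶_ B D y

  ∥_∥ : System → ℕ
  ∥ Q ∥ = sum (order ∘ System.walk Q)

  module _ (Q : System) where
    open System Q

    Shorter : Set
    Shorter = Σ[ Q′ ∈ System ] ∥ Q′ ∥ < ∥ Q ∥

    Off : Fin n → Set
    Off v = ∀ j → ¬ v on walk j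

    replace : ∀ j {b} → b ∈ B → (w : Star _⟶_ b (y j)) → (∀ {x} → x on w → x ∉ D) →
      (∀ {x} → x on w → ∀ i → x on walk i → i ≡ j) → order w < order (walk j) → Shorter
    replace j {b} b∈B w w-avoids w-owner shorter = Q′ , sum-mono-< (λ i → ≤-all i (i Fin.≟ j)) j (<-at (j Fin.≟ j))
      where
      -- All fields take the decision of `i ≡ j` as an argument, so that one match on `yes refl`
      -- identifies the replaced walk.
      src : ∀ {i} → Dec (i ≡ j) → Fin n
      src     (yes _) = b
      src {i} (no _)  = start i
      src∈B : ∀ {i} (d : Dec (i ≡ j)) → src d ∈ B
      src∈B     (yes _) = b∈B
      src∈B {i} (no _)  = start∈B i
      wlk : ∀ {i} (d : Dec (i ≡ j)) → Star _⟶_ (src d) (y i)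
      wlk     (yes refl) = w
      wlk {i} (no _)     = walk i
      avd : ∀ {i} (d : Dec (i ≡ j)) {v} → v on wlk d → v ∉ D
      avd     (yes refl) = w-avoids
      avd {i} (no _)     = avoids i
      dis : ∀ {i i′} (d : Dec (i ≡ j)) (d′ : Dec (i′ ≡ j)) {v} → v on wlk d → v on wlk d′ → i ≡ i′
      dis (yes refl) (yes refl) _  _   = refl
      dis (yes refl) (no _)     v∈ v∈′ = sym (w-owner v∈ _ v∈′)
      dis (no _)     (yes refl) v∈ v∈′ = w-owner v∈′ _ v∈
      dis (no _)     (no _)     v∈ v∈′ = disjoint _ _ v∈ v∈′
      Q′ : System
      Q′ = record
        { start    = λ i → src (i Fin.≟ j)
        ; start∈B  = λ i → src∈B (i Fin.≟ j)
        ; walk     = λ i → wlk (i Fin.≟ j)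
        ; avoids   = λ i → avd (i Fin.≟ j)
        ; disjoint = λ i i′ → dis (i Fin.≟ j) (i′ Fin.≟ j)
        }
      ≤-all : ∀ i (d : Dec (i ≡ j)) → order (wlk d) ≤ order (walk i)
      ≤-all i (yes refl) = <⇒≤ shorter
      ≤-all i (no _)     = ≤-refl
      <-at : ∀ (d : Dec (j ≡ j)) → order (wlk d) < order (walk j)
      <-at (yes refl) = shorter
      <-at (no j≢j)   = contradiction refl j≢j

    -- Four is the largest order of a path that `enter` grafts onto a walk.
    F : List (Fin n)
    F = List.concat (List.tabulate λ j → take 4 (vertices _⟶_ (walk j)))

    ∣F∣≤k*4 : length F ≤ k * 4
    ∣F∣≤k*4 = length-concat-tabulate _ λ j →
      ≤-trans (≤-reflexive (length-take 4 (vertices _⟶_ (walk j)))) (m⊓n≤m 4 _)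

    take-4⊆F : ∀ j {v} → v List.∈ take 4 (vertices _⟶_ (walk j)) → v List.∈ F
    take-4⊆F j v∈ = ∈-concat⁺′ v∈ (∈-tabulate⁺ j)

    -- If w ended on a walk of the system beyond its first four vertices, then w followed
    -- by the rest of that walk would be a shortcut.
    enter : ∀ {b v} → b ∈ B → (w : Star _⟶_ b v) → order w ≤ 4 → (∀ {x} → x on w → x ∉ D) →
      (∀ {x} → x on w → x ≡ v ⊎ Off x) → v List.∉ F → Shorter ⊎ Off v
    enter {b} {v} b∈B w ∣w∣≤4 w-avoids w-off v∉F
      with Fin.any? (λ j → DecMembership._∈?_ Fin._≟_ v (vertices _⟶_ (walk j)))
    ... | no  off      = inj₂ λ j v∈ → off (j , v∈)
    ... | yes (j , v∈) with suffix 4 (walk j) v∈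
    ...   | inj₁ v∈take              = contradiction (take-4⊆F j v∈take) v∉F
    ...   | inj₂ (w′ , ∣w′∣≤ , ⊆walk) = inj₁ (replace j b∈B (w ◅◅ w′)
              (λ x∈ → [ w-avoids , avoids j ∘ ⊆walk ]′ (on-◅◅⁻ w w′ x∈))
              (λ x∈ i x∈i → case on-◅◅⁻ w w′ x∈ of λ where
                (inj₂ x∈w′) → disjoint i j x∈i (⊆walk x∈w′)
                (inj₁ x∈w)  → case w-off x∈w of λ where
                  (inj₁ refl) → disjoint i j x∈i v∈
                  (inj₂ off)  → contradiction x∈i (off i))
              -- The junction is counted once: at most three vertices replace at least four.
              (≤-trans (≤-reflexive (order-◅◅ w w′)) (≤-trans (+-monoˡ-≤ (order w′) ∣w∣≤4) ∣w′∣≤)))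

    -- A certificate that `v` is near `B`. If its path, prolonged by one edge, hits a walk late, it
    -- can be grafted there to shorten the system; `t` bounds the cost.
    record Reach (t : ℕ) (v : Fin n) : Set where
      field
        {source} : Fin n
        source∈B : source ∈ B
        path     : Star _⟶_ source v
        order≤t  : order path ≤ t
        clear    : ∀ {x} → x on path → x ∉ D × Off x

    reach-clear : ∀ {t v} → Reach t v → v ∉ D × Off v
    reach-clear r = Reach.clear r (target-on (Reach.path r))

    launch : ∀ {b} → b ∈ B → b ∉ D → b List.∉ F → Shorter ⊎ Reach 1 b
    launch b∈B b∉D b∉F with enter b∈B ε (s≤s z≤n) (λ { (here refl) → b∉D }) (λ { (here refl) → inj₁ refl }) b∉F
    ... | inj₁ shorter = inj₁ shorter
    ... | inj₂ off     = inj₂ record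
      { source∈B = b∈B ; path = ε ; order≤t = ≤-refl ; clear = λ { (here refl) → b∉D , off } }

    extend : ∀ {t v z} → suc t ≤ 4 → Reach t v → v ⟶ z → z ∉ D → z List.∉ F → Shorter ⊎ Reach (suc t) z
    extend {t} {v} {z} t<4 r v⟶z z∉D z∉F =
      case enter source∈B w (≤-trans ∣w∣≤ t<4) w-avoids w-off z∉F of λ where
        (inj₁ shorter) → inj₁ shorter
        (inj₂ off)     → inj₂ record
          { source∈B = source∈B ; path = w ; order≤t = ∣w∣≤
          ; clear = λ x∈ → w-avoids x∈ , [ (λ { refl → off }) , id ]′ (w-off x∈) }
      where
      open Reach r
      w = path ◅◅ (v⟶z ◅ ε)
      ∣w∣≤ : order w ≤ suc t
      ∣w∣≤ = ≤-pred (≤-trans (≤-reflexive (trans (order-◅◅ path (v⟶z ◅ ε)) (+-comm _ 2))) (s≤s (s≤s order≤t)))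
      on-w : ∀ {x} → x on w → x on path ⊎ x ≡ z
      on-w x∈ with on-◅◅⁻ path (v⟶z ◅ ε) x∈
      ... | inj₁ x∈path             = inj₁ x∈path
      ... | inj₂ (here refl)         = inj₁ (target-on path)
      ... | inj₂ (there (here x≡z)) = inj₂ x≡z
      w-avoids : ∀ {x} → x on w → x ∉ D
      w-avoids x∈ = [ proj₁ ∘ clear , (λ { refl → z∉D }) ]′ (on-w x∈)
      w-off : ∀ {x} → x on w → x ≡ z ⊎ Off x
      w-off x∈ = [ inj₂ ∘ proj₂ ∘ clear , inj₁ ]′ (on-w x∈)

-- Degree and connectivity hypotheses, and the constants

δ⁺≤outdegree : (D : Digraph (suc n)) (x : Fin (suc n)) → δ⁺ D ≤ Digraph.outdegree D x
δ⁺≤outdegree D = minimum≤ (Digraph.outdegree D)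
  where
  minimum≤ : ∀ {n} (f : Fin (suc n) → ℕ) x → foldr₁ _⊓_ (tabulate f) ≤ f x
  minimum≤ {zero}  f zero    = ≤-refl
  minimum≤ {suc n} f zero    = m⊓n≤m _ _
  minimum≤ {suc n} f (suc x) = ≤-trans (m⊓n≤n (f zero) _) (minimum≤ (f ∘ suc) x)

module _ (T : Digraph n) (S : Subset n) where
  open Digraph T
  open Walk _⟶_

  undelete : ∀ {p q} → Star (Delete T S) p q → Σ[ w ∈ Star _⟶_ (proj₁ p) (proj₁ q) ] (∀ {x} → x on w → x ∉ S)
  undelete {u , u∈∁S} ε       = ε , λ { (here refl) → x∈∁p⇒x∉p u∈∁S }
  undelete {u , u∈∁S} (e ◅ w) with undelete w
  ... | w′ , avoids = e ◅ w′ , λ { (here refl) → x∈∁p⇒x∉p u∈∁S ; (there x∈) → avoids x∈ }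

connected-outside : (T : Digraph n) → ∀ {m} → StronglyMConnected T m →
  ∀ S → ∣ S ∣ < m → ∀ {u v} → u ∉ S → v ∉ S →
  Σ[ w ∈ Star (Digraph._⟶_ T) u v ] (∀ {x} → x List.∈ vertices (Digraph._⟶_ T) w → x ∉ S)
connected-outside T conn S ∣S∣<m {u} {v} u∉S v∉S with u Fin.≟ v
... | yes refl = ε , λ { (here refl) → u∉S }
... | no u≢v   = undelete T S (Path.walk
  (conn S ∣S∣<m (u , x∉p⇒x∈∁p u∉S) (v , x∉p⇒x∈∁p v∉S) (u≢v ∘ cong proj₁)))

-- N = 9k bounds the number of vertices to be avoided at any time: 2k in D, 4k in F and 3k
-- on the links built so far.  With 2N + 2 hubs, a vertex that dominates at most N of them
-- is dominated by more than N.
hubs degree : ℕ → ℕ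
hubs   N = suc (suc N + N)
degree N = hubs N + N + 2 ^ suc N

-- Linking the given pairs

module Linking {n k N : ℕ} (9*k≤N : 9 * k ≤ N) (T : Digraph n) (tournament : IsTournament T)
  (conn : StronglyMConnected T (4 * k)) (large : ∀ v → degree N ≤ Digraph.outdegree T v) (hubs≤n : hubs N ≤ n)
  (x y : Fin k → Fin n) (x-injective : Injective _≡_ _≡_ x) (y-injective : Injective _≡_ _≡_ y)
  (x≢y : ∀ i j → x i ≢ y j) where

  open Digraph T
  open Tournament T tournament
  open Walk _⟶_

  abstract
    top : Σ[ B ∈ Subset n ] ∣ B ∣ ≡ hubs N × (∀ {b u} → b ∈ B → u ∉ B → ∣ N⁻ u ∣ ≤ ∣ N⁻ b ∣)
    top = top-set (∣_∣ ∘ N⁻) (hubs N) hubs≤n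

  B : Subset n
  B = proj₁ top

  ∣B∣≡hubs : ∣ B ∣ ≡ hubs N
  ∣B∣≡hubs = proj₁ (proj₂ top)

  sees-many? : ∀ u → Dec (N < ∣ B ∩ N⁺ u ∣)
  sees-many? u = N <? ∣ B ∩ N⁺ u ∣

  seen? : ∀ v u → Dec (v ⟶ u × ¬ N < ∣ B ∩ N⁺ u ∣)
  seen? v u = v ⟶? u ×-dec ¬? (sees-many? u)

  -- By `seen⇒many-hubs`, more than `N` hubs dominate each of these out-neighbours, so they have
  -- certificates of order 2.
  Seen : Fin n → Subset n
  Seen v = ⟪ seen? v ⟫

  seen⇒many-hubs : ∀ {u} → ¬ N < ∣ B ∩ N⁺ u ∣ → N < ∣ B ∩ N⁻ u ∣
  seen⇒many-hubs {u} few = +-cancelʳ-< N _ _ (≤-pred (begin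
    suc (suc N + N)                              ≡⟨ ∣B∣≡hubs ⟨
    ∣ B ∣                                        ≤⟨ neighbours B u ⟩
    suc (∣ B ∩ N⁺ u ∣ + ∣ B ∩ N⁻ u ∣)            ≤⟨ s≤s (+-monoˡ-≤ (∣ B ∩ N⁻ u ∣) (≮⇒≥ few)) ⟩
    suc (N + ∣ B ∩ N⁻ u ∣)                       ≡⟨ cong suc (+-comm N _) ⟩
    suc (∣ B ∩ N⁻ u ∣ + N)                       ∎))
    where open ≤-Reasoning

  record Relay (i : Fin k) : Set where
    field
      relay   : Fin n
      x⟶relay : x i ⟶ relay
      exit    : N < ∣ B ∩ N⁺ relay ∣ ⊎ N < ∣ Seen (x i) ∣

  choose-relay : ∀ i used → length used ≤ N →
    Empty.⊥ ⊎ Σ[ r ∈ Relay i ] length (Relay.relay r ∷ []) ≤ 1 × Disjoint used (Relay.relay r ∷ [])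
  choose-relay i used ∣used∣≤N with N <? ∣ Seen (x i) ∣
  ... | yes many =
    -- The many seen out-neighbours provide the exit, so any out-neighbour outside `used` can be the
    -- relay.
    let u , x⟶u , u∉used = length<∣p∣⇒∃∈p∖xs {p = N⁺ (x i)} used (≤-<-trans ∣used∣≤N (<-≤-trans many
          (p⊆q⇒∣p∣≤∣q∣ {q = N⁺ (x i)} (proj₁ ∘ ∈⟪⟫⁻ (seen? (x i))))))
    in inj₂ (record { relay = u ; x⟶relay = x⟶u ; exit = inj₂ many } , ≤-refl ,
             λ { (u∈used , here refl) → u∉used u∈used })
  ... | no few =
    let u , u∈ , u∉used = length<∣p∣⇒∃∈p∖xs {p = N⁺ (x i) ─ Seen (x i)} used (≤-<-trans ∣used∣≤N N<)
        x⟶u = p─q⊆p (N⁺ (x i)) (Seen (x i)) u∈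
        u∉Seen = x∈p─q⇒x∉q (N⁺ (x i)) (Seen (x i)) u∈
    in inj₂ (record { relay = u ; x⟶relay = x⟶u
                    ; exit = inj₁ (decidable-stable (sees-many? u) λ ¬many → u∉Seen (∈⟪⟫⁺ (seen? (x i)) (x⟶u , ¬many))) }
            , ≤-refl , λ { (u∈used , here refl) → u∉used u∈used })
    where
    open ≤-Reasoning
    N< : N < ∣ N⁺ (x i) ─ Seen (x i) ∣
    N< = +-cancelʳ-< N _ _ (begin-strict
      N + N                                         <⟨ s≤s (n≤1+n _) ⟩
      hubs N                                        ≤⟨ ≤-trans (m≤m+n _ _) (m≤m+n _ _) ⟩
      degree N                                      ≤⟨ large (x i) ⟩
      ∣ N⁺ (x i) ∣                                  ≤⟨ ∣p∣≤∣p─q∣+∣q∣ (N⁺ (x i)) (Seen (x i)) ⟩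
      ∣ N⁺ (x i) ─ Seen (x i) ∣ + ∣ Seen (x i) ∣    ≤⟨ +-monoʳ-≤ (∣ N⁺ (x i) ─ Seen (x i) ∣) (≮⇒≥ few) ⟩
      ∣ N⁺ (x i) ─ Seen (x i) ∣ + N                 ∎)

  X Y : List (Fin n)
  X = List.tabulate x
  Y = List.tabulate y

  abstract
    -- Avoiding `X ++ Y` lets the relays be deleted together with the `x i` without losing any
    -- `y j`.
    relays : Σ[ r ∈ (∀ i → Relay i) ] (∀ i → Disjoint (X ++ Y) (Relay.relay (r i) ∷ [])) ×
      (∀ i j {v} → v List.∈ Relay.relay (r i) ∷ [] → v List.∈ Relay.relay (r j) ∷ [] → i ≡ j)
    relays = [ Empty.⊥-elim , id ]′ (greedy (λ r → Relay.relay r ∷ []) 1 N choose-relay (X ++ Y) (begin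
      length (X ++ Y) + k * 1           ≡⟨ cong (_+ k * 1) (length-++ X) ⟩
      length X + length Y + k * 1       ≡⟨ cong₂ (λ a b → a + b + k * 1) (length-tabulate x) (length-tabulate y) ⟩
      k + k + k * 1                     ≤⟨ m≤m+n _ (6 * k) ⟩
      k + k + k * 1 + 6 * k             ≡⟨ solve 1 (λ k → k :+ k :+ k :* con 1 :+ con 6 :* k := con 9 :* k) refl k ⟩
      9 * k                             ≤⟨ 9*k≤N ⟩
      N                                 ∎))
      where
      open ≤-Reasoning
      open +-*-Solver

  module R i = Relay (proj₁ relays i)

  r : Fin k → Fin n
  r = R.relay

  r-injective : ∀ {i j} → r i ≡ r j → i ≡ j
  r-injective ri≡rj = proj₂ (proj₂ relays) _ _ (here refl) (here ri≡rj)

  x≢r : ∀ {i j} → x i ≢ r j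
  x≢r {i} {j} x≡r = proj₁ (proj₂ relays) j (∈-++⁺ˡ (∈-tabulate⁺ i) , here x≡r)

  y≢r : ∀ {i j} → y i ≢ r j
  y≢r {i} {j} y≡r = proj₁ (proj₂ relays) j (∈-++⁺ʳ X (∈-tabulate⁺ i) , here y≡r)

  Ds : List (Fin n)
  Ds = X ++ List.tabulate r

  D : Subset n
  D = fromList Ds

  ∣Ds∣≡k+k : length Ds ≡ k + k
  ∣Ds∣≡k+k = trans (length-++ X) (cong₂ _+_ (length-tabulate x) (length-tabulate r))

  -- Menger's theorem needs connectivity after the loss of fewer than `∣ D ∣ + k` vertices; this
  -- bound places that within `4 * k`.
  ∣D∣+k≤3*k : ∣ D ∣ + k ≤ 3 * k
  ∣D∣+k≤3*k = begin
    ∣ D ∣ + k         ≤⟨ +-monoˡ-≤ k (∣fromList∣≤length Ds) ⟩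
    length Ds + k     ≡⟨ cong (_+ k) ∣Ds∣≡k+k ⟩
    k + k + k         ≡⟨ solve 1 (λ k → k :+ k :+ k := con 3 :* k) refl k ⟩
    3 * k             ∎
    where
    open ≤-Reasoning
    open +-*-Solver

  x∈D : ∀ i → x i ∈ D
  x∈D i = ∈-fromList⁺ (∈-++⁺ˡ (∈-tabulate⁺ i))

  r∈D : ∀ i → r i ∈ D
  r∈D i = ∈-fromList⁺ (∈-++⁺ʳ X (∈-tabulate⁺ i))

  y∉D : ∀ j → y j ∉ D
  y∉D j y∈D with ∈-++⁻ X (∈-fromList⁻ Ds y∈D)
  ... | inj₁ y∈X = let i , y≡x = ∈-tabulate⁻ y∈X in x≢y i j (sym y≡x)
  ... | inj₂ y∈R = y≢r (proj₂ (∈-tabulate⁻ y∈R))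

  open Linkage _⟶_ B D y
  open Reroute _⟶_ B D y

  abstract
    initial-system : System
    initial-system = Menger.menger _⟶?_ y-injective y∉D
      (begin
        ∣ D ∣ + k    ≤⟨ ∣D∣+k≤3*k ⟩
        3 * k        ≤⟨ ≤-trans (*-monoˡ-≤ k {3} {9} (s≤s (s≤s (s≤s z≤n)))) 9*k≤N ⟩
        N            ≤⟨ ≤-trans (m≤n+m N (suc N)) (n≤1+n _) ⟩
        hubs N       ≡⟨ ∣B∣≡hubs ⟨
        ∣ B ∣        ∎)
      (λ S ∣S∣< → connected-outside T conn S
        (<-≤-trans ∣S∣< (≤-trans ∣D∣+k≤3*k (*-monoˡ-≤ k {3} {4} (s≤s (s≤s (s≤s z≤n)))))))
      where open ≤-Reasoning

  Goal : Set
  Goal = Σ[ P ∈ (∀ i → Path _⟶_ (x i) (y i)) ] (∀ i j → i ≢ j → VertexDisjoint _⟶_ (P i) (P j))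

  module _ (Q : System) where
    open System Q

    -- The vertices are sorted by kind: ends in `D`, fresh ones off `D` and all walks, and the start
    -- of walk `i`. Two links can thus clash only in their `fresh` parts.
    record Link (i : Fin k) : Set where
      field
        fresh       : List (Fin n)
        fresh-clear : ∀ {v} → v List.∈ fresh → v ∉ D × Off Q v
        link        : Star _⟶_ (x i) (start i)
        on-link     : ∀ {v} → v on link → v List.∈ (x i ∷ r i ∷ []) ⊎ v List.∈ fresh ⊎ v ≡ start i

    open Link

    NewLink : Fin k → List (Fin n) → Set
    NewLink i used = Shorter Q ⊎ Σ[ l ∈ Link i ] length (fresh l) ≤ 3 × Disjoint used (fresh l)

    module _ (i : Fin k) (used : List (Fin n)) (∣used∣≤ : length used ≤ k * 3) where

      L : List (Fin n)
      L = Ds ++ F Q ++ used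

      ∣L∣≤N : length L ≤ N
      ∣L∣≤N = begin
        length (Ds ++ F Q ++ used)               ≡⟨ length-++ Ds ⟩
        length Ds + length (F Q ++ used)         ≡⟨ cong₂ _+_ ∣Ds∣≡k+k (length-++ (F Q)) ⟩
        k + k + (length (F Q) + length used)     ≤⟨ +-monoʳ-≤ (k + k) (+-mono-≤ (∣F∣≤k*4 Q) ∣used∣≤) ⟩
        k + k + (k * 4 + k * 3)                  ≡⟨ solve 1 (λ k → k :+ k :+ (k :* con 4 :+ k :* con 3) := con 9 :* k) refl k ⟩
        9 * k                                    ≤⟨ 9*k≤N ⟩
        N                                        ∎
        where
        open ≤-Reasoning
        open +-*-Solver

      ∉D : ∀ {v} → v List.∉ L → v ∉ D
      ∉D v∉L = v∉L ∘ ∈-++⁺ˡ ∘ ∈-fromList⁻ Ds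

      ∉F : ∀ {v} → v List.∉ L → v List.∉ F Q
      ∉F v∉L = v∉L ∘ ∈-++⁺ʳ Ds ∘ ∈-++⁺ˡ

      ∉used : ∀ {v} → v List.∉ L → v List.∉ used
      ∉used v∉L = v∉L ∘ ∈-++⁺ʳ Ds ∘ ∈-++⁺ʳ (F Q)

      -- Two paths to `v` grow together: `path` from `x i` becomes the link, while `reach` from `B`
      -- certifies that `v` is off the walks. `t` bounds the order of the latter, `s` the new
      -- vertices of the former.
      record Approach (t s : ℕ) (v : Fin n) : Set where
        field
          reach       : Reach Q t v
          visited     : List (Fin n)
          ∣visited∣≤s : length visited ≤ s
          v∈visited   : v List.∈ visited
          clear       : ∀ {u} → u List.∈ visited → u List.∉ L × u ∉ D × Off Q u
          path        : Star _⟶_ (x i) v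
          on-path     : ∀ {u} → u on path → u List.∈ (x i ∷ r i ∷ []) ⊎ u List.∈ visited

      begin-at : ∀ {t v} → Reach Q t v → v List.∉ L → (p : Star _⟶_ (x i) v) →
        (∀ {u} → u on p → u List.∈ (x i ∷ r i ∷ []) ⊎ u List.∈ (v ∷ [])) → Approach t 1 v
      begin-at {v = v} reach v∉L p on-p = record
        { reach = reach ; visited = v ∷ [] ; ∣visited∣≤s = ≤-refl ; v∈visited = here refl
        ; clear = λ { (here refl) → v∉L , reach-clear Q reach } ; path = p ; on-path = on-p }

      step : ∀ {t s v u} → suc t ≤ 4 → Approach t s v → v ⟶ u → u List.∉ L → Shorter Q ⊎ Approach (suc t) (suc s) u
      step {t} {s} {v} {u} t<4 a v⟶u u∉L = [ inj₁ , inj₂ ∘ continue ]′ (extend Q t<4 reach v⟶u (∉D u∉L) (∉F u∉L))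
        where
        open Approach a
        on-step : ∀ {z} → z on path ◅◅ (v⟶u ◅ ε) → z List.∈ (x i ∷ r i ∷ []) ⊎ z List.∈ (u ∷ visited)
        on-step z∈ with on-◅◅⁻ path (v⟶u ◅ ε) z∈
        ... | inj₁ z∈path             = [ inj₁ , inj₂ ∘ there ]′ (on-path z∈path)
        ... | inj₂ (here refl)         = inj₂ (there v∈visited)
        ... | inj₂ (there (here refl)) = inj₂ (here refl)
        continue : Reach Q (suc t) u → Approach (suc t) (suc s) u
        continue reach-u = record
          { reach = reach-u ; visited = u ∷ visited ; ∣visited∣≤s = s≤s ∣visited∣≤s ; v∈visited = here refl
          ; clear = λ { (here refl) → u∉L , reach-clear Q reach-u ; (there z∈) → clear z∈ }
          ; path = path ◅◅ (v⟶u ◅ ε) ; on-path = on-step }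

      arrive : ∀ {t s v} → s ≤ 3 → Approach t s v → v ⟶ start i → NewLink i used
      arrive {v = v} s≤3 a v⟶b = inj₂
        ( record { fresh = visited ; fresh-clear = proj₂ ∘ clear ; link = path ◅◅ (v⟶b ◅ ε) ; on-link = on-arrival }
        , ≤-trans ∣visited∣≤s s≤3
        , λ (u∈used , u∈visited) → ∉used (proj₁ (clear u∈visited)) u∈used )
        where
        open Approach a
        on-arrival : ∀ {z} → z on path ◅◅ (v⟶b ◅ ε) →
          z List.∈ (x i ∷ r i ∷ []) ⊎ z List.∈ visited ⊎ z ≡ start i
        on-arrival z∈ with on-◅◅⁻ path (v⟶b ◅ ε) z∈
        ... | inj₁ z∈path             = [ inj₁ , inj₂ ∘ inj₁ ]′ (on-path z∈path)
        ... | inj₂ (here refl)         = inj₂ (inj₁ v∈visited)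
        ... | inj₂ (there (here refl)) = inj₂ (inj₂ refl)

      -- A short path has at most two interior vertices, so certificates keep within order 4, the
      -- limit in `enter`, and the link has at most three fresh vertices.
      finish : ∀ {t v} → t ≤ 2 → Approach t 1 v → NewLink i used
      finish {t} {v} t≤2 a =
        case short-path (proj₂ (proj₂ top)) L ∣L∣≤N v
               -- `degree N` is the bound of `short-path` with `hubs N` for the size of `B`.
               (subst (λ m → m + N + 2 ^ suc N ≤ outdegree v) (sym ∣B∣≡hubs) (large v)) (start∈B i) of λ where
          (one v⟶b) → arrive (s≤s z≤n) a v⟶b
          (two v⟶u u⟶b u∉L) → [ inj₁ , (λ a-u → arrive (s≤s (s≤s z≤n)) a-u u⟶b) ]′ (step t<4 a v⟶u u∉L)
          (three v⟶u u⟶w w⟶b u∉L w∉L) → [ inj₁ , (λ a-u →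
            [ inj₁ , (λ a-w → arrive ≤-refl a-w w⟶b) ]′ (step (s≤s (s≤s t≤2)) a-u u⟶w w∉L)) ]′ (step t<4 a v⟶u u∉L)
        where
        t<4 : suc t ≤ 4
        t<4 = s≤s (m≤n⇒m≤1+n t≤2)

      new-link : NewLink i used
      new-link with R.exit i
      ... | inj₁ r-sees-many =
        -- The link passes through the relay into the hub `b`, whose certificate is the trivial
        -- path.
        let b , b∈ , b∉L = length<∣p∣⇒∃∈p∖xs L (≤-<-trans ∣L∣≤N r-sees-many)
            b∈B , r⟶b = x∈p∩q⁻ B (N⁺ (r i)) b∈
        in [ inj₁ , (λ reach-b → finish (s≤s z≤n) (begin-at reach-b b∉L (R.x⟶relay i ◅ r⟶b ◅ ε)
               λ { (here refl) → inj₁ (here refl) ; (there (here refl)) → inj₁ (there (here refl))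
                 ; (there (there u∈)) → inj₂ u∈ })) ]′
           (launch Q b∈B (∉D b∉L) (∉F b∉L))
      ... | inj₂ many-seen =
        -- The link goes straight to `u`; the hub `b` is where the certificate of `u` begins.
        let u , u∈ , u∉L = length<∣p∣⇒∃∈p∖xs L (≤-<-trans ∣L∣≤N many-seen)
            x⟶u , few = ∈⟪⟫⁻ (seen? (x i)) u∈
            b , b∈ , b∉L = length<∣p∣⇒∃∈p∖xs L (≤-<-trans ∣L∣≤N (seen⇒many-hubs few))
            b∈B , b∈N⁻u = x∈p∩q⁻ B (N⁻ u) b∈
        in [ inj₁ , (λ reach-b →
             [ inj₁ , (λ reach-u → finish ≤-refl (begin-at reach-u u∉L (x⟶u ◅ ε)
               λ { (here refl) → inj₁ (here refl) ; (there z∈) → inj₂ z∈ })) ]′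
             (extend Q (s≤s (s≤s z≤n)) reach-b (∈N⁻⁻ b∈N⁻u) (∉D u∉L) (∉F u∉L))) ]′
           (launch Q b∈B (∉D b∉L) (∉F b∉L))

    ends-owner : ∀ i j {v} → v List.∈ (x i ∷ r i ∷ []) → v List.∈ (x j ∷ r j ∷ []) → i ≡ j
    ends-owner i j (here refl)         (here eq)          = x-injective eq
    ends-owner i j (here refl)         (there (here eq))  = contradiction eq x≢r
    ends-owner i j (there (here refl)) (here eq)          = contradiction (sym eq) x≢r
    ends-owner i j (there (here refl)) (there (here eq))  = r-injective eq

    ends∈D : ∀ i {v} → v List.∈ (x i ∷ r i ∷ []) → v ∈ D
    ends∈D i (here refl)         = x∈D i
    ends∈D i (there (here refl)) = r∈D i

    solve-with : Shorter Q ⊎ Goal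
    solve-with with greedy fresh 3 (k * 3) new-link [] ≤-refl
    ... | inj₁ shorter = inj₁ shorter
    ... | inj₂ (links , _ , fresh-owner) = inj₂
      ( (λ i → proj₁ (path i))
      , λ i j i≢j (v∈i , v∈j) → i≢j (owner i j (part i (proj₂ (path i) v∈i)) (part j (proj₂ (path j) v∈j))) )
      where
      path : ∀ i → Σ[ p ∈ Path _⟶_ (x i) (y i) ] (∀ {v} → v on Path.walk p → v on link (links i) ◅◅ walk i)
      path i = walk⇒path Fin._≟_ (link (links i) ◅◅ walk i)
      -- Different kinds never meet: ends lie in `D`, which walks and fresh vertices avoid, and
      -- fresh vertices are off all walks. Within one kind, a vertex determines its index.
      data Part (i : Fin k) (v : Fin n) : Set where
        end   : v List.∈ (x i ∷ r i ∷ []) → Part i v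
        inner : v List.∈ fresh (links i) → Part i v
        old   : v on walk i → Part i v
      part : ∀ i {v} → v on link (links i) ◅◅ walk i → Part i v
      part i v∈ with on-◅◅⁻ (link (links i)) (walk i) v∈
      ... | inj₂ v∈walk = old v∈walk
      ... | inj₁ v∈link with on-link (links i) v∈link
      ...   | inj₁ v∈xr           = end v∈xr
      ...   | inj₂ (inj₁ v∈fresh) = inner v∈fresh
      -- The junction of link and walk is counted with the walk.
      ...   | inj₂ (inj₂ refl)    = old (source-on (walk i))
      owner : ∀ i j {v} → Part i v → Part j v → i ≡ j
      owner i j (end v∈)   (end v∈′)   = ends-owner i j v∈ v∈′
      owner i j (end v∈)   (inner v∈′) = contradiction (ends∈D i v∈) (proj₁ (fresh-clear (links j) v∈′))
      owner i j (end v∈)   (old v∈′)   = contradiction (ends∈D i v∈) (avoids j v∈′)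
      owner i j (inner v∈) (end v∈′)   = contradiction (ends∈D j v∈′) (proj₁ (fresh-clear (links i) v∈))
      owner i j (inner v∈) (inner v∈′) = fresh-owner i j v∈ v∈′
      owner i j (inner v∈) (old v∈′)   = contradiction v∈′ (proj₂ (fresh-clear (links i) v∈) j)
      owner i j (old v∈)   (end v∈′)   = contradiction (ends∈D j v∈′) (avoids i v∈)
      owner i j (old v∈)   (inner v∈′) = contradiction v∈ (proj₂ (fresh-clear (links j) v∈′) i)
      owner i j (old v∈)   (old v∈′)   = disjoint i j v∈ v∈′

  goal : Goal
  goal = descend initial-system (<-wellFounded _)
    where
    descend : (Q : System) → Acc _<_ ∥ Q ∥ → Goal
    descend Q (acc rec) = case solve-with Q of λ where
      (inj₁ (Q′ , ∥Q′∥<∥Q∥)) → descend Q′ (rec ∥Q′∥<∥Q∥)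
      (inj₂ done)            → done

theorem1p1 : (k : ℕ) → 0 < k →
    Σ[ d ∈ ℕ ] (0 < d ×
    ((n : ℕ) (T : Digraph (suc n)) → IsTournament T →
    StronglyMConnected T (4 * k) → d ≤ δ⁺ T →
    IsLinked (Digraph._⟶_ T) k))
theorem1p1 k _ = degree (9 * k) , s≤s z≤n , λ n T tournament conn d≤δ⁺ →
  let large = λ v → ≤-trans d≤δ⁺ (δ⁺≤outdegree T v)
      -- The out-degree of a single vertex already forces enough vertices to choose the hubs from.
      hubs≤n = ≤-trans (≤-trans (m≤m+n _ _) (m≤m+n _ _)) (≤-trans (large zero) (∣p∣≤n (Digraph.N⁺ T zero)))
  in Linking.goal ≤-refl T tournament conn large hubs≤n
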